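{- Let $N=\prod_{i=1}^\ell p_i^{r_i}$ be a positive integer, where $p_1,\dots,p_\ell$ are distinct primes and $r_1,\dots,r_\ell\ge 1$. Let $\mu\ge 1$ and let $f\in\mathbb{Z}[X_1,\dots,X_\mu]$ be any $\mu$-linear polynomial that is co-prime to $N$. Then for every integer $m>1$, if $\mathbf{x}=(x_1,\dots,x_\mu)$ is sampled uniformly from $\{0,1,\dots,m-1\}^\mu$, $$\Pr_{\mathbf{x}}\big[f(\mathbf{x})\equiv 0 \pmod N\big]\;\le\;\frac{\mu}{m}+\prod_{i=1}^{\ell} I_{1/p_i}(r_i,\mu).$$
   Context: A polynomial $f\in\mathbb{Z}[X_1,\dots,X_\mu]$ is $\mu$-linear (multilinear) if it has degree at most $1$ in each variable $X_i$. $f$ is co-prime to $N$ if the greatest common divisor of $N$ and all coefficients of $f$ equals $1$. For $\epsilon\in(0,1)$ and integers $k\ge 0$, $\mu\ge 1$, the regularized (incomplete) beta function is $I_\epsilon(k,\mu)=(1-\epsilon)^\mu\sum_{j=k}^{\infty}\binom{\mu+j-1}{j}\epsilon^j$; equivalently, it is the probability that $Z_1+\dots+Z_\mu\ge k$, where $Z_1,\dots,Z_\mu$ are i.i.d. nonnegative-integer random variables with $\Pr[Z_i\ge s]=\epsilon^s$ for all $s\ge 0$. -}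

module Defs where

open import Data.Integer as ℤ using (ℤ; +_)
import Data.Integer.Properties as ℤ
open import Data.Integer.Divisibility.Signed using (_∣_; _∣?_)
open import Data.List as List using (List; []; _∷_; foldr; filter; length; upTo)
open import Data.List.Properties using (length-++; length-map; length-upTo)
open import Data.Nat as ℕ using (ℕ; zero; suc; NonZero; s≤s; z≤n)
import Data.Nat.Properties as ℕ
open import Data.Nat.Combinatorics using (_C_; nCk+nC[k+1]≡[n+1]C[k+1]; k>n⇒nCk≡0)
open import Data.Nat.Coprimality using (1-coprimeTo) renaming (sym to coprime-sym)
open import Data.Nat.GCD using (gcd)
open import Data.Nat.Primality using (Prime; prime⇒nonZero; prime⇒nonTrivial)
open import Data.Product using (∃; _,_; proj₁; proj₂)
open import Data.Rational as ℚ hiding (NonZero)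
open import Data.Rational.Properties
open import Data.Rational.Solver using (module +-*-Solver)
open import Data.Vec using (Vec; []; _∷_; lookup)
open import Relation.Binary.PropositionalEquality
open import Relation.Unary using (Pred; Decidable)

open import Algebra.Definitions.RawSemiring +-*-rawSemiring
  using (_^_; product) public
open import Algebra.Definitions.RawSemiring ℕ.+-*-rawSemiring
  using () renaming (product to productℕ) public

------------------------------------------------------------------------
-- Integer polynomials

-- ℤ[X₁,…,X_μ] as iterated univariate polynomials: `poly (a₀ ∷ a₁ ∷ …)` is
-- a₀ + a₁ X₁ + a₂ X₁² + …, with each aᵢ a polynomial in X₂,…,X_μ.  Trailing
-- zeros are allowed, so one polynomial has several representations.
data Poly : ℕ → Set where
  const : ℤ → Poly 0
  poly  : ∀ {μ} → List (Poly μ) → Poly (suc μ)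

mutual
  eval : ∀ {μ} → Poly μ → Vec ℤ μ → ℤ
  eval (const c) []       = c
  eval (poly as) (x ∷ xs) = horner as x xs

  horner : ∀ {μ} → List (Poly μ) → ℤ → Vec ℤ μ → ℤ
  horner []       x xs = ℤ.0ℤ
  horner (a ∷ as) x xs = eval a xs ℤ.+ x ℤ.* horner as x xs

-- The coefficient of X₁^e₁ ⋯ X_μ^e_μ.
mutual
  coeff : ∀ {μ} → Poly μ → Vec ℕ μ → ℤ
  coeff (const c) []       = c
  coeff (poly as) (e ∷ es) = coeffAt as e es

  coeffAt : ∀ {μ} → List (Poly μ) → ℕ → Vec ℕ μ → ℤ
  coeffAt []       _       _  = ℤ.0ℤ
  coeffAt (a ∷ as) zero    es = coeff a es
  coeffAt (a ∷ as) (suc e) es = coeffAt as e es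

-- All coefficients; those not listed are zero and do not affect gcds.
mutual
  coeffs : ∀ {μ} → Poly μ → List ℤ
  coeffs (const c) = c ∷ []
  coeffs (poly as) = coeffsOf as

  coeffsOf : ∀ {μ} → List (Poly μ) → List ℤ
  coeffsOf []       = []
  coeffsOf (a ∷ as) = coeffs a List.++ coeffsOf as

Multilinear : ∀ {μ} → Poly μ → Set
Multilinear f = ∀ e → coeff f e ≢ ℤ.0ℤ → ∀ i → lookup e i ℕ.≤ 1

CoprimeTo : ∀ {μ} → ℕ → Poly μ → Set
CoprimeTo N f = foldr (λ c d → gcd ℤ.∣ c ∣ d) N (coeffs f) ≡ 1

------------------------------------------------------------------------
-- Uniform sampling from {0,…,m-1}^μ

cube : ℕ → (μ : ℕ) → List (Vec ℤ μ)
cube m zero    = [] ∷ []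
cube m (suc μ) = List.cartesianProductWith (λ x xs → + x ∷ xs) (upTo m) (cube m μ)

length-cube : ∀ m μ → length (cube m μ) ≡ m ℕ.^ μ
length-cube m zero    = refl
length-cube m (suc μ) = trans (length-product (upTo m)) (cong₂ ℕ._*_ (length-upTo m) (length-cube m μ))
  where
  length-product : ∀ ns → length (List.cartesianProductWith (λ x xs → + x ∷ xs) ns (cube m μ)) ≡
                          length ns ℕ.* length (cube m μ)
  length-product []       = refl
  length-product (n ∷ ns) = trans (length-++ (List.map (+ n ∷_) (cube m μ)))
    (cong₂ ℕ._+_ (length-map (+ n ∷_) (cube m μ)) (length-product ns))

Pr : ∀ m μ .{{_ : NonZero m}} {ℓ} {P : Pred (Vec ℤ μ) ℓ} → Decidable P → ℚ
Pr m μ P? = (+ length (filter P? (cube m μ)) / (m ℕ.^ μ)) {{ℕ.m^n≢0 m μ}}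

vanishesMod? : ∀ {μ} (f : Poly μ) (N : ℕ) → Decidable (λ x → + N ∣ eval f x)
vanishesMod? f N x = + N ∣? eval f x

------------------------------------------------------------------------
-- Rational series

-- For rational ε the series below have rational sums (`binomTerm-summable`),
-- so limits can be taken in ℚ.
partialSum : (ℕ → ℚ) → ℕ → ℚ
partialSum a zero    = 0ℚ
partialSum a (suc n) = partialSum a n + a n

_⟶_ : (ℕ → ℚ) → ℚ → Set
s ⟶ L = ∀ δ → 0ℚ < δ → ∃ λ n₀ → ∀ n → n₀ ℕ.≤ n → ∣ s n - L ∣ < δ

Summable : (ℕ → ℚ) → Set
Summable a = ∃ λ L → partialSum a ⟶ L

∑∞ : (a : ℕ → ℚ) → Summable a → ℚ
∑∞ a = proj₁

------------------------------------------------------------------------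
-- The regularized beta function

record OpenUnitInterval : Set where
  constructor inUnit
  field
    value   : ℚ
    0<value : 0ℚ < value
    value<1 : value < 1ℚ

open OpenUnitInterval

binomTerm : ℚ → ℕ → ℕ → ℚ
binomTerm ε μ j = (+ ((μ ℕ.+ j ℕ.∸ 1) C j) / 1) * ε ^ j

ι : ℕ → ℚ
ι n = + n / 1

ι≡ : ∀ n → ι n ≡ mkℚ (+ n) 0 (coprime-sym (1-coprimeTo n))
ι≡ n = normalize-coprime (coprime-sym (1-coprimeTo n))

ι-mono : ∀ {m n} → m ℕ.≤ n → ι m ≤ ι n
ι-mono {m} {n} m≤n = subst₂ _≤_ (sym (ι≡ m)) (sym (ι≡ n))
  (*≤* (ℤ.*-monoʳ-≤-nonNeg (+ 1) (ℤ.+≤+ m≤n)))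

ι-+ : ∀ m n → ι (m ℕ.+ n) ≡ ι m + ι n
ι-+ m n = trans (cong (_/ 1) lem) (sym (cong₂ _+_ (ι≡ m) (ι≡ n)))
  where
  lem : + (m ℕ.+ n) ≡ + m ℤ.* + 1 ℤ.+ + n ℤ.* + 1
  lem = sym (cong₂ ℤ._+_ (ℤ.*-identityʳ (+ m)) (ℤ.*-identityʳ (+ n)))

below-ι : ∀ q → ∃ λ n → q < ι n
below-ι q@(mkℚ a d _) = suc ℤ.∣ a ∣ , subst (q <_) (sym (ι≡ (suc ℤ.∣ a ∣))) (*<* (begin-strict
  a ℤ.* + 1                      ≡⟨ ℤ.*-identityʳ a ⟩
  a                              ≤⟨ i≤∣i∣ a ⟩
  + ℤ.∣ a ∣                      <⟨ ℤ.+<+ ℕ.≤-refl ⟩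
  + suc ℤ.∣ a ∣                  ≤⟨ ℤ.+≤+ (ℕ.m≤m*n (suc ℤ.∣ a ∣) (suc d)) ⟩
  + (suc ℤ.∣ a ∣ ℕ.* suc d)      ≡⟨ ℤ.pos-* (suc ℤ.∣ a ∣) (suc d) ⟩
  + suc ℤ.∣ a ∣ ℤ.* + suc d      ∎))
  where
  open ℤ.≤-Reasoning
  i≤∣i∣ : ∀ i → i ℤ.≤ + ℤ.∣ i ∣
  i≤∣i∣ (+ n)       = ℤ.≤-refl
  i≤∣i∣ ℤ.-[1+ n ]  = ℤ.-≤+

½-split : ∀ x → x ≡ ½ * x + ½ * x
½-split = solve 1 (λ x → x := con ½ :* x :+ con ½ :* x) refl
  where open +-*-Solver

*-mono-nonNeg : ∀ {p q} r → 0ℚ ≤ r → p ≤ q → r * p ≤ r * q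
*-mono-nonNeg r 0≤r = *-monoˡ-≤-nonNeg r {{nonNegative 0≤r}}

*-mono-pos : ∀ {p q} r → 0ℚ < r → p < q → r * p < r * q
*-mono-pos r 0<r = *-monoʳ-<-pos r {{positive 0<r}}

*-pos : ∀ {p q} → 0ℚ < p → 0ℚ < q → 0ℚ < p * q
*-pos {p} {q} 0<p 0<q = subst (_< p * q) (*-zeroʳ p) (*-mono-pos p 0<p 0<q)

-- By Pascal's rule the partial sums satisfy
-- P (μ+1) (n+1) = P μ (n+1) + ε P (μ+1) n, which contracts to
-- Σⱼ C(μ+j-1, j) εʲ = (1 - ε)^(-μ) by induction on μ.
module Contraction (ε : ℚ) (0<ε : 0ℚ < ε) (ε<1 : ε < 1ℚ) where
  open +-*-Solver

  c : ℚ
  c = 1ℚ - ε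

  0<c : 0ℚ < c
  0<c = subst (_< c) (+-inverseʳ ε) (+-monoˡ-< (- ε) ε<1)

  instance
    c≢0 : ℚ.NonZero c
    c≢0 = pos⇒nonZero c {{positive 0<c}}

  c⁻¹ : ℚ
  c⁻¹ = 1/ c

  0≤ε : 0ℚ ≤ ε
  0≤ε = <⇒≤ 0<ε

  0<ε^ : ∀ k → 0ℚ < ε ^ k
  0<ε^ zero    = positive⁻¹ 1ℚ
  0<ε^ (suc k) = *-pos 0<ε (0<ε^ k)

  ε^≤1 : ∀ k → ε ^ k ≤ 1ℚ
  ε^≤1 zero    = ≤-refl
  ε^≤1 (suc k) = begin
    ε * ε ^ k  ≤⟨ *-mono-nonNeg ε 0≤ε (ε^≤1 k) ⟩
    ε * 1ℚ     ≡⟨ *-identityʳ ε ⟩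
    ε          ≤⟨ <⇒≤ ε<1 ⟩
    1ℚ         ∎
    where open ≤-Reasoning

  bernoulli : ∀ k → ε ^ k * (ι k * c) ≤ 1ℚ - ε ^ k
  bernoulli zero    = ≤-reflexive (solve 1
    (λ e → con 1ℚ :* (con 0ℚ :* (con 1ℚ :- e)) := con 1ℚ :- con 1ℚ) refl ε)
  bernoulli (suc k) = begin
    ε ^ suc k * (ι (suc k) * c)                  ≡⟨ cong (λ z → ε ^ suc k * (z * c)) (ι-+ 1 k) ⟩
    ε * ε ^ k * ((1ℚ + ι k) * c)                 ≡⟨ solve 4 (λ e t i c → e :* t :* ((con 1ℚ :+ i) :* c) := e :* (t :* (i :* c)) :+ c :* (e :* t)) refl ε (ε ^ k) (ι k) c ⟩
    ε * (ε ^ k * (ι k * c)) + c * ε ^ suc k      ≤⟨ +-mono-≤ (*-mono-nonNeg ε 0≤ε (bernoulli k)) (*-mono-nonNeg c (<⇒≤ 0<c) (ε^≤1 (suc k))) ⟩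
    ε * (1ℚ - ε ^ k) + c * 1ℚ                    ≡⟨ solve 2 (λ e t → e :* (con 1ℚ :- t) :+ (con 1ℚ :- e) :* con 1ℚ := con 1ℚ :- e :* t) refl ε (ε ^ k) ⟩
    1ℚ - ε ^ suc k                               ∎
    where open ≤-Reasoning

  geometric→0 : ∀ a → 0ℚ ≤ a → ∀ δ → 0ℚ < δ → ∃ λ K → ∀ k → K ℕ.≤ k → ε ^ k * a < δ
  geometric→0 a 0≤a δ 0<δ = K , bound
    where
    cδ : ℚ
    cδ = c * δ
    0<cδ : 0ℚ < cδ
    0<cδ = *-pos 0<c 0<δ
    instance
      cδ≢0 : ℚ.NonZero cδ
      cδ≢0 = pos⇒nonZero cδ {{positive 0<cδ}}
    K : ℕ
    K = proj₁ (below-ι (1/ cδ * a))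
    open ≤-Reasoning
    bound : ∀ k → K ℕ.≤ k → ε ^ k * a < δ
    bound k K≤k = begin-strict
      ε ^ k * a                    ≡⟨ cong (ε ^ k *_) (sym (trans (sym (*-assoc cδ (1/ cδ) a)) (trans (cong (_* a) (*-inverseʳ cδ)) (*-identityˡ a)))) ⟩
      ε ^ k * (cδ * (1/ cδ * a))   <⟨ *-mono-pos (ε ^ k) (0<ε^ k) (*-mono-pos cδ 0<cδ (<-≤-trans (proj₂ (below-ι (1/ cδ * a))) (ι-mono K≤k))) ⟩
      ε ^ k * (cδ * ι k)           ≡⟨ solve 4 (λ t c d i → t :* (c :* d :* i) := d :* (t :* (i :* c))) refl (ε ^ k) c δ (ι k) ⟩
      δ * (ε ^ k * (ι k * c))      ≤⟨ *-mono-nonNeg δ (<⇒≤ 0<δ) (bernoulli k) ⟩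
      δ * (1ℚ - ε ^ k)             ≤⟨ *-mono-nonNeg δ (<⇒≤ 0<δ) (+-monoʳ-≤ 1ℚ (neg-antimono-≤ (<⇒≤ (0<ε^ k)))) ⟩
      δ * (1ℚ - 0ℚ)                ≡⟨ *-identityʳ δ ⟩
      δ                            ∎

  contraction : ∀ (s v : ℕ → ℚ) V → (∀ n → s (suc n) ≡ v (suc n) + ε * s n) →
                v ⟶ V → s ⟶ (c⁻¹ * V)
  contraction s v V rec v→V δ 0<δ = K ℕ.+ n₀ , result
    where
    open ≤-Reasoning
    L η : ℚ
    L = c⁻¹ * V
    η = ½ * δ
    0<η : 0ℚ < η
    0<η = *-pos (positive⁻¹ ½) 0<δ
    near : ∃ λ n₀ → ∀ n → n₀ ℕ.≤ n → ∣ v n - V ∣ < c * η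
    near = v→V (c * η) (*-pos 0<c 0<η)
    n₀ : ℕ
    n₀ = proj₁ near
    a : ℚ
    a = ∣ s n₀ - L ∣
    small : ∃ λ K → ∀ k → K ℕ.≤ k → ε ^ k * a < η
    small = geometric→0 a (0≤∣p∣ (s n₀ - L)) η 0<η
    K : ℕ
    K = proj₁ small

    V≡cL : V ≡ c * L
    V≡cL = sym (trans (sym (*-assoc c c⁻¹ V)) (trans (cong (_* V) (*-inverseʳ c)) (*-identityˡ V)))

    step : ∀ n → s (suc n) - L ≡ ε * (s n - L) + (v (suc n) - V)
    step n = begin-equality
      s (suc n) - L                          ≡⟨ cong (_- L) (rec n) ⟩
      v (suc n) + ε * s n - L                ≡⟨ solve 4 (λ v e s l → v :+ e :* s :- l := e :* (s :- l) :+ (v :- (con 1ℚ :- e) :* l)) refl (v (suc n)) ε (s n) L ⟩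
      ε * (s n - L) + (v (suc n) - c * L)    ≡⟨ cong (λ z → ε * (s n - L) + (v (suc n) - z)) (sym V≡cL) ⟩
      ε * (s n - L) + (v (suc n) - V)        ∎

    decay : ∀ k → ∣ s (k ℕ.+ n₀) - L ∣ ≤ ε ^ k * a + η
    decay zero    = begin
      a              ≡⟨ sym (trans (+-identityʳ (1ℚ * a)) (*-identityˡ a)) ⟩
      1ℚ * a + 0ℚ    ≤⟨ +-monoʳ-≤ (1ℚ * a) (<⇒≤ 0<η) ⟩
      1ℚ * a + η     ∎
    decay (suc k) = begin
      ∣ s (suc n) - L ∣                              ≡⟨ cong ∣_∣ (step n) ⟩
      ∣ ε * (s n - L) + (v (suc n) - V) ∣            ≤⟨ ∣p+q∣≤∣p∣+∣q∣ (ε * (s n - L)) (v (suc n) - V) ⟩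
      ∣ ε * (s n - L) ∣ + ∣ v (suc n) - V ∣          ≡⟨ cong (_+ ∣ v (suc n) - V ∣) (trans (∣p*q∣≡∣p∣*∣q∣ ε (s n - L)) (cong (_* ∣ s n - L ∣) (0≤p⇒∣p∣≡p 0≤ε))) ⟩
      ε * ∣ s n - L ∣ + ∣ v (suc n) - V ∣            ≤⟨ +-mono-≤ (*-mono-nonNeg ε 0≤ε (decay k)) (<⇒≤ (proj₂ near (suc n) (ℕ.m≤n⇒m≤1+n (ℕ.m≤n+m n₀ k)))) ⟩
      ε * (ε ^ k * a + η) + c * η                    ≡⟨ solve 4 (λ e t a h → e :* (t :* a :+ h) :+ (con 1ℚ :- e) :* h := e :* t :* a :+ h) refl ε (ε ^ k) a η ⟩
      ε ^ suc k * a + η                              ∎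
      where
      n : ℕ
      n = k ℕ.+ n₀

    result : ∀ n → K ℕ.+ n₀ ℕ.≤ n → ∣ s n - L ∣ < δ
    result n le = begin-strict
      ∣ s n - L ∣                        ≡⟨ cong (λ z → ∣ s z - L ∣) (sym (ℕ.m∸n+n≡m (ℕ.m+n≤o⇒n≤o K le))) ⟩
      ∣ s (n ℕ.∸ n₀ ℕ.+ n₀) - L ∣        ≤⟨ decay (n ℕ.∸ n₀) ⟩
      ε ^ (n ℕ.∸ n₀) * a + η             <⟨ +-monoˡ-< η (proj₂ small (n ℕ.∸ n₀) (ℕ.m+n≤o⇒m≤o∸n K le)) ⟩
      η + η                              ≡⟨ sym (½-split δ) ⟩
      δ                                  ∎

  P : ℕ → ℕ → ℚ
  P μ = partialSum (binomTerm ε μ)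

  binomTerm-suc : ∀ μ i → binomTerm ε (suc μ) (suc i) ≡
                  binomTerm ε μ (suc i) + ε * binomTerm ε (suc μ) i
  binomTerm-suc μ i rewrite ℕ.+-suc μ i = begin
    ι (suc (μ ℕ.+ i) C suc i) * (ε * ε ^ i)                        ≡⟨ cong (λ z → ι z * (ε * ε ^ i)) (sym (nCk+nC[k+1]≡[n+1]C[k+1] (μ ℕ.+ i) i)) ⟩
    ι ((μ ℕ.+ i) C i ℕ.+ (μ ℕ.+ i) C suc i) * (ε * ε ^ i)          ≡⟨ cong (_* (ε * ε ^ i)) (ι-+ ((μ ℕ.+ i) C i) ((μ ℕ.+ i) C suc i)) ⟩
    (ι ((μ ℕ.+ i) C i) + ι ((μ ℕ.+ i) C suc i)) * (ε * ε ^ i)      ≡⟨ solve 4 (λ x y e t → (x :+ y) :* (e :* t) := y :* (e :* t) :+ e :* (x :* t)) refl (ι ((μ ℕ.+ i) C i)) (ι ((μ ℕ.+ i) C suc i)) ε (ε ^ i) ⟩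
    ι ((μ ℕ.+ i) C suc i) * (ε * ε ^ i) + ε * (ι ((μ ℕ.+ i) C i) * ε ^ i) ∎
    where open ≡-Reasoning

  P-suc : ∀ μ n → P (suc μ) (suc n) ≡ P μ (suc n) + ε * P (suc μ) n
  P-suc μ zero    = begin
    0ℚ + ι 1 * 1ℚ                 ≡⟨ sym (+-identityʳ (0ℚ + ι 1 * 1ℚ)) ⟩
    0ℚ + ι 1 * 1ℚ + 0ℚ            ≡⟨ cong (_+_ (0ℚ + ι 1 * 1ℚ)) (sym (*-zeroʳ ε)) ⟩
    0ℚ + ι 1 * 1ℚ + ε * 0ℚ        ∎
    where open ≡-Reasoning
  P-suc μ (suc n) = begin
    P (suc μ) (suc n) + binomTerm ε (suc μ) (suc n)                   ≡⟨ cong₂ _+_ (P-suc μ n) (binomTerm-suc μ n) ⟩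
    (P μ (suc n) + ε * P (suc μ) n) + (binomTerm ε μ (suc n) + ε * binomTerm ε (suc μ) n)
      ≡⟨ solve 5 (λ p e q b d → (p :+ e :* q) :+ (b :+ e :* d) := (p :+ b) :+ e :* (q :+ d)) refl (P μ (suc n)) ε (P (suc μ) n) (binomTerm ε μ (suc n)) (binomTerm ε (suc μ) n) ⟩
    P μ (suc (suc n)) + ε * P (suc μ) (suc n)                         ∎
    where open ≡-Reasoning

  P0≡1 : ∀ n → P 0 (suc n) ≡ 1ℚ
  P0≡1 zero    = refl
  P0≡1 (suc n) = begin
    P 0 (suc n) + ι (n C suc n) * ε ^ suc n   ≡⟨ cong₂ (λ x y → x + ι y * ε ^ suc n) (P0≡1 n) (k>n⇒nCk≡0 {n} {suc n} ℕ.≤-refl) ⟩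
    1ℚ + 0ℚ * ε ^ suc n                       ≡⟨ cong (λ z → 1ℚ + z) (*-zeroˡ (ε ^ suc n)) ⟩
    1ℚ                                        ∎
    where open ≡-Reasoning

  P-converges : ∀ μ → P μ ⟶ (c⁻¹ ^ μ)
  P-converges zero δ 0<δ = 1 , λ { (suc n) _ → subst (λ z → ∣ z - 1ℚ ∣ < δ) (sym (P0≡1 n)) 0<δ }
  P-converges (suc μ) = contraction (P (suc μ)) (P μ) (c⁻¹ ^ μ) (P-suc μ) (P-converges μ)

partialSum-drop : ∀ a k n → partialSum (λ j → a (k ℕ.+ j)) n ≡ partialSum a (k ℕ.+ n) - partialSum a k
partialSum-drop a k zero    rewrite ℕ.+-identityʳ k = sym (+-inverseʳ (partialSum a k))
partialSum-drop a k (suc n) rewrite ℕ.+-suc k n = begin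
  partialSum (λ j → a (k ℕ.+ j)) n + a (k ℕ.+ n)           ≡⟨ cong (_+ a (k ℕ.+ n)) (partialSum-drop a k n) ⟩
  partialSum a (k ℕ.+ n) - partialSum a k + a (k ℕ.+ n)    ≡⟨ solve 3 (λ x y z → x :- y :+ z := x :+ z :- y) refl (partialSum a (k ℕ.+ n)) (partialSum a k) (a (k ℕ.+ n)) ⟩
  partialSum a (k ℕ.+ n) + a (k ℕ.+ n) - partialSum a k    ∎
  where open ≡-Reasoning
        open +-*-Solver

summable-drop : ∀ a k → Summable a → Summable (λ j → a (k ℕ.+ j))
summable-drop a k (L , conv) = L - partialSum a k , λ δ 0<δ → let n₀ , near = conv δ 0<δ in
  n₀ , λ n n₀≤n → subst (λ z → ∣ z ∣ < δ) (sym (shift n)) (near (k ℕ.+ n) (ℕ.≤-trans n₀≤n (ℕ.m≤n+m n k)))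
  where
  open +-*-Solver
  shift : ∀ n → partialSum (λ j → a (k ℕ.+ j)) n - (L - partialSum a k) ≡ partialSum a (k ℕ.+ n) - L
  shift n = trans (cong (_- (L - partialSum a k)) (partialSum-drop a k n))
    (solve 3 (λ x y l → x :- y :- (l :- y) := x :- l) refl (partialSum a (k ℕ.+ n)) (partialSum a k) L)

binomTerm-summable : ∀ (ε : OpenUnitInterval) μ → Summable (binomTerm (value ε) μ)
binomTerm-summable (inUnit ε 0<ε ε<1) μ = _ , Contraction.P-converges ε 0<ε ε<1 μ

-- The sum over j ≥ k is reindexed as a sum over all j of the (k + j)-th term.
I : OpenUnitInterval → ℕ → ℕ → ℚ
I ε k μ = (1ℚ - value ε) ^ μ *
  ∑∞ (λ j → binomTerm (value ε) μ (k ℕ.+ j))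
     (summable-drop (binomTerm (value ε) μ) k (binomTerm-summable ε μ))

reciprocal : ∀ {p} → Prime p → OpenUnitInterval
reciprocal {p} p-prime = inUnit ((+ 1 / p) {{prime⇒nonZero p-prime}})
  (0<1/ p {{prime⇒nonZero p-prime}}) (1/<1 p {{prime⇒nonZero p-prime}} {{prime⇒nonTrivial p-prime}})
  where
  1/≡ : ∀ d → + 1 / suc d ≡ mkℚ (+ 1) d (1-coprimeTo (suc d))
  1/≡ d = normalize-coprime (1-coprimeTo (suc d))

  0<1/ : ∀ n .{{_ : NonZero n}} → 0ℚ < + 1 / n
  0<1/ (suc d) = subst (0ℚ <_) (sym (1/≡ d)) (positive⁻¹ _)

  1/<1 : ∀ n .{{_ : NonZero n}} .{{_ : ℕ.NonTrivial n}} → + 1 / n < 1ℚ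
  1/<1 (suc (suc d)) = subst (_< 1ℚ) (sym (1/≡ (suc d))) (*<* (ℤ.+<+ (s≤s (s≤s z≤n))))

{-# OPTIONS --safe #-}
module Submission where

-- Substitute the variables one at a time and follow, for each p_j, the
-- valuation of the content of the remaining polynomial, capped at r_j.  If
-- g + x h and g + y h both gain t_j factors p_j over the content of g + X h for
-- every j, then ∏ p_j^t_j divides x - y, so among x < m this has probability
-- at most 1/m + ∏ p_j^(-t_j).  Hence each step behaves like independent
-- geometric variables with Pr[Z_j ≥ t] = p_j^(-t), up to an error of 1/m in
-- every joint tail.  Integrating these tail bounds against the product of the
-- monotone functions t ↦ I(k_j - t, μ), whose total increase is at most 1,
-- costs only 1/m per variable.

open import Defs
open import Data.Bool using (true; false)
open import Data.Fin using (Fin; zero; suc)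
import Data.Fin.Properties as Fin
open import Data.Integer as ℤ using (ℤ; +_)
import Data.Integer.Properties as ℤ
import Data.Integer.Divisibility.Signed as ℤ
open import Data.Integer.Tactic.RingSolver using (solve-∀)
open import Data.List using (List; []; _∷_; _++_; map; filter; foldr; length; upTo; cartesianProductWith)
open import Data.List.Properties using (filter-++; filter-reject; length-filter; length-++; upTo-∷ʳ; ++-identityʳ; cartesianProductWith-distribʳ-++)
open import Data.List.Relation.Unary.All as All using (All; []; _∷_)
import Data.List.Relation.Unary.All.Properties as All
open import Data.Nat as ℕ using (ℕ; zero; suc; NonZero; z≤n; s≤s)
import Data.Nat.Properties as ℕ
open import Data.Nat.Divisibility as ℕ using (_∣_; _∤_; _∣?_; divides)
open import Data.Nat.GCD using (gcd; gcd-greatest)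
open import Data.Nat.Primality using (Prime; prime⇒nonZero; prime⇒irreducible; euclidsLemma; ¬prime[1])
open import Data.Product using (∃; _×_; _,_; proj₁; proj₂)
open import Data.Rational using (ℚ; _≤_; _<_; _+_; _/_; _*_; _-_; -_; 0ℚ; 1ℚ; positive; toℚᵘ)
open import Data.Rational.Properties
open import Data.Rational.Solver using (module +-*-Solver)
import Data.Rational.Unnormalised as ℚᵘ
import Data.Rational.Unnormalised.Properties as ℚᵘ
open import Data.Sum using (_⊎_; inj₁; inj₂)
open import Data.Vec using (Vec; []; _∷_)
open import Data.Vec.Functional as Vector using (Vector)
open import Function using (_∘_)
open import Function.Definitions using (Injective)
open import Relation.Binary.PropositionalEquality
open import Relation.Nullary using (¬_; Dec; yes; no; contradiction)
open import Relation.Nullary.Decidable using (_×-dec_; does; decidable-stable)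
open import Relation.Unary using (Pred; Decidable)

-- Rational arithmetic and finite sums.

*-nonNeg : ∀ {p q} → 0ℚ ≤ p → 0ℚ ≤ q → 0ℚ ≤ p * q
*-nonNeg {p} {q} 0≤p 0≤q = subst (_≤ p * q) (*-zeroʳ p) (*-mono-nonNeg p 0≤p 0≤q)

0≤ι : ∀ n → 0ℚ ≤ ι n
0≤ι n = ι-mono {0} {n} z≤n

≤⇒0≤- : ∀ {p q} → p ≤ q → 0ℚ ≤ q - p
≤⇒0≤- {p} {q} p≤q = subst (_≤ q - p) (+-inverseʳ p) (+-monoˡ-≤ (- p) p≤q)

product-nonNeg : ∀ {ℓ} (v : Vector ℚ ℓ) → (∀ i → 0ℚ ≤ v i) → 0ℚ ≤ product v
product-nonNeg {zero}  v 0≤v = 0≤ι 1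
product-nonNeg {suc ℓ} v 0≤v = *-nonNeg (0≤v zero) (product-nonNeg (Vector.tail v) (0≤v ∘ suc))

product-ones : ∀ {ℓ} (v : Vector ℚ ℓ) → (∀ i → v i ≡ 1ℚ) → product v ≡ 1ℚ
product-ones {zero}  v v≡1 = refl
product-ones {suc ℓ} v v≡1 = cong₂ _*_ (v≡1 zero) (product-ones (Vector.tail v) (v≡1 ∘ suc))

-- Multiplying back out captures `_/_` independently of its reduced form; the unnormalised rationals
-- make the check immediate.
/-*-cancel : ∀ a d .{{_ : NonZero d}} → (+ a / d) * ι d ≡ ι a
/-*-cancel a d@(suc _) = toℚᵘ-injective (begin-equality
  toℚᵘ ((+ a / d) * ι d)           ≃⟨ toℚᵘ-homo-* (+ a / d) (ι d) ⟩
  toℚᵘ (+ a / d) ℚᵘ.* toℚᵘ (ι d)   ≃⟨ ℚᵘ.*-cong (toℚᵘ-fromℚᵘ (+ a ℚᵘ./ d)) (toℚᵘ-fromℚᵘ (+ d ℚᵘ./ 1)) ⟩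
  (+ a ℚᵘ./ d) ℚᵘ.* (+ d ℚᵘ./ 1)   ≃⟨ ℚᵘ.*≡* (trans (ℤ.*-identityʳ (+ a ℤ.* + d)) (cong (λ z → + a ℤ.* + z) (sym (ℕ.*-identityʳ d)))) ⟩
  + a ℚᵘ./ 1                       ≃⟨ toℚᵘ-fromℚᵘ (+ a ℚᵘ./ 1) ⟨
  toℚᵘ (ι a)                       ∎)
  where open ℚᵘ.≤-Reasoning

ι-* : ∀ m n → ι (m ℕ.* n) ≡ ι m * ι n
ι-* zero    n = sym (*-zeroˡ (ι n))
ι-* (suc m) n = begin
  ι (n ℕ.+ m ℕ.* n)       ≡⟨ ι-+ n (m ℕ.* n) ⟩
  ι n + ι (m ℕ.* n)       ≡⟨ cong (λ z → ι n + z) (ι-* m n) ⟩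
  ι n + ι m * ι n         ≡⟨ solve 2 (λ x y → x :+ y :* x := (con 1ℚ :+ y) :* x) refl (ι n) (ι m) ⟩
  (1ℚ + ι m) * ι n        ≡⟨ cong (_* ι n) (ι-+ 1 m) ⟨
  ι (suc m) * ι n         ∎
  where open ≡-Reasoning
        open +-*-Solver

ι-^ : ∀ m k → ι (m ℕ.^ k) ≡ ι m ^ k
ι-^ m zero    = refl
ι-^ m (suc k) = trans (ι-* m (m ℕ.^ k)) (cong (ι m *_) (ι-^ m k))

^-nonNeg : ∀ {q} → 0ℚ ≤ q → ∀ k → 0ℚ ≤ q ^ k
^-nonNeg 0≤q zero    = 0≤ι 1
^-nonNeg 0≤q (suc k) = *-nonNeg 0≤q (^-nonNeg 0≤q k)

partialSum-cong : ∀ {f g} → (∀ x → f x ≡ g x) → ∀ n → partialSum f n ≡ partialSum g n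
partialSum-cong f≡g zero    = refl
partialSum-cong f≡g (suc n) = cong₂ _+_ (partialSum-cong f≡g n) (f≡g n)

partialSum-mono : ∀ {f g} → (∀ x → f x ≤ g x) → ∀ n → partialSum f n ≤ partialSum g n
partialSum-mono f≤g zero    = ≤-refl
partialSum-mono f≤g (suc n) = +-mono-≤ (partialSum-mono f≤g n) (f≤g n)

partialSum-+ : ∀ f g n → partialSum (λ x → f x + g x) n ≡ partialSum f n + partialSum g n
partialSum-+ f g zero    = refl
partialSum-+ f g (suc n) = trans (cong (_+ (f n + g n)) (partialSum-+ f g n))
  (solve 4 (λ a b c d → a :+ b :+ (c :+ d) := a :+ c :+ (b :+ d)) refl (partialSum f n) (partialSum g n) (f n) (g n))
  where open +-*-Solver

partialSum-*ˡ : ∀ a f n → partialSum (λ x → a * f x) n ≡ a * partialSum f n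
partialSum-*ˡ a f zero    = sym (*-zeroʳ a)
partialSum-*ˡ a f (suc n) = trans (cong (_+ a * f n) (partialSum-*ˡ a f n)) (sym (*-distribˡ-+ a (partialSum f n) (f n)))

partialSum-const : ∀ a n → partialSum (λ _ → a) n ≡ ι n * a
partialSum-const a zero    = sym (*-zeroˡ a)
partialSum-const a (suc n) = begin
  partialSum (λ _ → a) n + a   ≡⟨ cong (_+ a) (partialSum-const a n) ⟩
  ι n * a + a                  ≡⟨ solve 2 (λ x y → x :* y :+ y := (con 1ℚ :+ x) :* y) refl (ι n) a ⟩
  (1ℚ + ι n) * a               ≡⟨ cong (_* a) (ι-+ 1 n) ⟨
  ι (suc n) * a                ∎
  where open ≡-Reasoning
        open +-*-Solver

-- Recursion and monotonicity of the regularized beta function.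

module BetaTail (e : OpenUnitInterval) where
  open OpenUnitInterval e renaming (value to ε; 0<value to 0<ε; value<1 to ε<1)
  open Contraction ε 0<ε ε<1
  open +-*-Solver

  c^*c⁻¹^≡1 : ∀ μ → c ^ μ * c⁻¹ ^ μ ≡ 1ℚ
  c^*c⁻¹^≡1 zero    = refl
  c^*c⁻¹^≡1 (suc μ) = begin
    c * c ^ μ * (c⁻¹ * c⁻¹ ^ μ)      ≡⟨ solve 4 (λ a b x y → a :* b :* (x :* y) := a :* x :* (b :* y)) refl c (c ^ μ) c⁻¹ (c⁻¹ ^ μ) ⟩
    c * c⁻¹ * (c ^ μ * c⁻¹ ^ μ)      ≡⟨ cong₂ _*_ (*-inverseʳ c) (c^*c⁻¹^≡1 μ) ⟩
    1ℚ                               ∎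
    where open ≡-Reasoning

  -- The sum inside `I` is by construction the limit `c⁻¹ ^ μ` minus the first `k` terms. Limits
  -- disappear here: every later fact about `I` is finite algebra with `P`.
  I-closed : ∀ k μ → I e k μ ≡ 1ℚ - c ^ μ * P μ k
  I-closed k μ = begin
    c ^ μ * (c⁻¹ ^ μ - P μ k)         ≡⟨ solve 3 (λ a b x → a :* (b :- x) := a :* b :- a :* x) refl (c ^ μ) (c⁻¹ ^ μ) (P μ k) ⟩
    c ^ μ * c⁻¹ ^ μ - c ^ μ * P μ k   ≡⟨ cong (_- c ^ μ * P μ k) (c^*c⁻¹^≡1 μ) ⟩
    1ℚ - c ^ μ * P μ k                ∎
    where open ≡-Reasoning

  I-zeroˡ : ∀ μ → I e 0 μ ≡ 1ℚ
  I-zeroˡ μ = trans (I-closed 0 μ) (cong (λ z → 1ℚ - z) (*-zeroʳ (c ^ μ)))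

  I-zeroʳ : ∀ k → I e (suc k) 0 ≡ 0ℚ
  I-zeroʳ k = trans (I-closed (suc k) 0) (cong (λ z → 1ℚ - 1ℚ * z) (P0≡1 k))

  -- Condition on one of the Zᵢ: it is 0 with probability 1 - ε, and otherwise
  -- Zᵢ - 1 is distributed like Zᵢ.
  I-suc : ∀ k μ → I e (suc k) (suc μ) ≡ c * I e (suc k) μ + ε * I e k (suc μ)
  I-suc k μ = begin
    I e (suc k) (suc μ)                                       ≡⟨ I-closed (suc k) (suc μ) ⟩
    1ℚ - c * c ^ μ * P (suc μ) (suc k)                        ≡⟨ cong (λ z → 1ℚ - c * c ^ μ * z) (P-suc μ k) ⟩
    1ℚ - c * c ^ μ * (P μ (suc k) + ε * P (suc μ) k)          ≡⟨ solve 4 (λ e t a b → con 1ℚ :- (con 1ℚ :- e) :* t :* (a :+ e :* b)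
                                                                   := (con 1ℚ :- e) :* (con 1ℚ :- t :* a) :+ e :* (con 1ℚ :- (con 1ℚ :- e) :* t :* b))
                                                                   refl ε (c ^ μ) (P μ (suc k)) (P (suc μ) k) ⟩
    c * (1ℚ - c ^ μ * P μ (suc k)) + ε * (1ℚ - c * c ^ μ * P (suc μ) k)
      ≡⟨ cong₂ (λ x y → c * x + ε * y) (I-closed (suc k) μ) (I-closed k (suc μ)) ⟨
    c * I e (suc k) μ + ε * I e k (suc μ)                     ∎
    where open ≡-Reasoning

  I-nonNeg : ∀ k μ → 0ℚ ≤ I e k μ
  I-nonNeg zero    μ       = ≤-trans (0≤ι 1) (≤-reflexive (sym (I-zeroˡ μ)))
  I-nonNeg (suc k) zero    = ≤-reflexive (sym (I-zeroʳ k))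
  I-nonNeg (suc k) (suc μ) = ≤-trans
    (+-mono-≤ (*-nonNeg (<⇒≤ 0<c) (I-nonNeg (suc k) μ)) (*-nonNeg 0≤ε (I-nonNeg k (suc μ))))
    (≤-reflexive (sym (I-suc k μ)))

  -- The weights `c` and `ε` in `I-suc` are nonnegative, so the inequality passes from the two terms
  -- to their sum. At `k = 0` the right side is 1, and `c + ε = 1` takes the place of the recursion
  -- there.
  I-antitone : ∀ k μ → I e (suc k) μ ≤ I e k μ
  I-antitone k zero = ≤-trans (≤-reflexive (I-zeroʳ k)) (I-nonNeg k 0)
  I-antitone zero (suc μ) = begin
    I e 1 (suc μ)                      ≡⟨ I-suc 0 μ ⟩
    c * I e 1 μ + ε * I e 0 (suc μ)    ≤⟨ +-monoˡ-≤ (ε * I e 0 (suc μ)) (*-mono-nonNeg c (<⇒≤ 0<c) (I-antitone 0 μ)) ⟩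
    c * I e 0 μ + ε * I e 0 (suc μ)    ≡⟨ cong₂ (λ x y → c * x + ε * y) (I-zeroˡ μ) (I-zeroˡ (suc μ)) ⟩
    c * 1ℚ + ε * 1ℚ                    ≡⟨ solve 1 (λ e → (con 1ℚ :- e) :* con 1ℚ :+ e :* con 1ℚ := con 1ℚ) refl ε ⟩
    1ℚ                                 ≡⟨ I-zeroˡ (suc μ) ⟨
    I e 0 (suc μ)                      ∎
    where open ≤-Reasoning
  I-antitone (suc k) (suc μ) = begin
    I e (suc (suc k)) (suc μ)                          ≡⟨ I-suc (suc k) μ ⟩
    c * I e (suc (suc k)) μ + ε * I e (suc k) (suc μ)  ≤⟨ +-mono-≤ (*-mono-nonNeg c (<⇒≤ 0<c) (I-antitone (suc k) μ)) (*-mono-nonNeg ε 0≤ε (I-antitone k (suc μ))) ⟩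
    c * I e (suc k) μ + ε * I e k (suc μ)              ≡⟨ I-suc k μ ⟨
    I e (suc k) (suc μ)                                ∎
    where open ≤-Reasoning

-- From joint tail bounds to expectations.

-- The indicator of `t ≤ s`, valued in ℚ so that it can serve as a weight. Lowering both arguments
-- by 1 is a computation, as the induction in `tail-integration` requires.
atLeast : ℕ → ℕ → ℚ
atLeast zero    s       = 1ℚ
atLeast (suc t) zero    = 0ℚ
atLeast (suc t) (suc s) = atLeast t s

atLeast-cases : ∀ t s → atLeast t s ≡ 0ℚ ⊎ (atLeast t s ≡ 1ℚ × t ℕ.≤ s)
atLeast-cases zero    s       = inj₂ (refl , z≤n)
atLeast-cases (suc t) zero    = inj₁ refl
atLeast-cases (suc t) (suc s) with atLeast-cases t s
... | inj₁ ≡0         = inj₁ ≡0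
... | inj₂ (≡1 , t≤s) = inj₂ (≡1 , s≤s t≤s)

product-atLeast-cases : ∀ {ℓ} (t s : Vector ℕ ℓ) →
  product (λ j → atLeast (t j) (s j)) ≡ 0ℚ ⊎
  (product (λ j → atLeast (t j) (s j)) ≡ 1ℚ × (∀ j → t j ℕ.≤ s j))
product-atLeast-cases {zero}  t s = inj₂ (refl , λ ())
product-atLeast-cases {suc ℓ} t s
  with atLeast-cases (t zero) (s zero) | product-atLeast-cases (t ∘ suc) (s ∘ suc)
... | inj₁ ≡0         | _               = inj₁ (trans (cong (_* rest) ≡0) (*-zeroˡ rest))
  where rest = product (λ j → atLeast (t (suc j)) (s (suc j)))
... | inj₂ _          | inj₁ ≡0         = inj₁ (trans (cong (first *_) ≡0) (*-zeroʳ first))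
  where first = atLeast (t zero) (s zero)
... | inj₂ (≡1 , t≤s) | inj₂ (≡1′ , ts) = inj₂ (cong₂ _*_ ≡1 ≡1′ , λ { zero → t≤s ; (suc j) → ts j })

-- Abel summation: k ↦ I e k μ is antitone, so tail bounds on the weighted
-- distribution of s integrate to a bound on the expectation of I e (n ∸ s) μ.
-- The lower cut-off β ≤ I e n μ makes the induction on n work, with the total
-- increase of I above β paying for the additive error A only once.
module _ (e : OpenUnitInterval) (μ m : ℕ) where
  open OpenUnitInterval e renaming (value to ε; 0<value to 0<ε; value<1 to ε<1)
  open BetaTail e
  open +-*-Solver

  tail-integration : ∀ n β A B (s : ℕ → ℕ) (w : ℕ → ℚ) → β ≤ I e n μ →
    (∀ t → partialSum (λ x → atLeast t (s x) * w x) m ≤ A + B * ε ^ t) →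
    partialSum (λ x → (I e (n ℕ.∸ s x) μ - β) * w x) m ≤ A * (1ℚ - β) + B * (I e n (suc μ) - β)
  tail-integration zero β A B s w β≤I tail = begin
    partialSum (λ x → (I e (0 ℕ.∸ s x) μ - β) * w x) m    ≡⟨ partialSum-cong (λ x → trans (cong (λ z → (z - β) * w x) (trans (cong (λ k → I e k μ) (ℕ.0∸n≡0 (s x))) (I-zeroˡ μ)))
                                                               (cong ((1ℚ - β) *_) (sym (*-identityˡ (w x))))) m ⟩
    partialSum (λ x → (1ℚ - β) * (1ℚ * w x)) m            ≡⟨ partialSum-*ˡ (1ℚ - β) (λ x → 1ℚ * w x) m ⟩
    (1ℚ - β) * partialSum (λ x → 1ℚ * w x) m              ≤⟨ *-mono-nonNeg (1ℚ - β) (≤⇒0≤- (≤-trans β≤I (≤-reflexive (I-zeroˡ μ)))) (tail 0) ⟩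
    (1ℚ - β) * (A + B * 1ℚ)                               ≡⟨ solve 3 (λ b x y → (con 1ℚ :- b) :* (x :+ y :* con 1ℚ) := x :* (con 1ℚ :- b) :+ y :* (con 1ℚ :- b)) refl β A B ⟩
    A * (1ℚ - β) + B * (1ℚ - β)                           ≡⟨ cong (λ z → A * (1ℚ - β) + B * (z - β)) (I-zeroˡ (suc μ)) ⟨
    A * (1ℚ - β) + B * (I e 0 (suc μ) - β)                ∎
    where open ≤-Reasoning
  tail-integration (suc n) β A B s w β≤I tail = begin
    partialSum (λ x → (I e (suc n ℕ.∸ s x) μ - β) * w x) m
      ≡⟨ partialSum-cong split m ⟩
    partialSum (λ x → (γ - β) * (1ℚ * w x) + (I e (n ℕ.∸ s′ x) μ - γ) * w′ x) m
      ≡⟨ partialSum-+ (λ x → (γ - β) * (1ℚ * w x)) (λ x → (I e (n ℕ.∸ s′ x) μ - γ) * w′ x) m ⟩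
    partialSum (λ x → (γ - β) * (1ℚ * w x)) m + partialSum (λ x → (I e (n ℕ.∸ s′ x) μ - γ) * w′ x) m
      ≤⟨ +-mono-≤ first (tail-integration n γ A (B * ε) s′ w′ (I-antitone n μ) tail′) ⟩
    (γ - β) * (A + B * 1ℚ) + (A * (1ℚ - γ) + B * ε * (I e n (suc μ) - γ))
      -- The errors combine to `A * ((γ - β) + (1ℚ - γ)) = A * (1ℚ - β)`; the main terms are the
      -- right side of `I-suc`.
      ≡⟨ solve 6 (λ g b x y e i → (g :- b) :* (x :+ y :* con 1ℚ) :+ (x :* (con 1ℚ :- g) :+ y :* e :* (i :- g))
                  := x :* (con 1ℚ :- b) :+ y :* ((con 1ℚ :- e) :* g :+ e :* i :- b)) refl γ β A B ε (I e n (suc μ)) ⟩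
    A * (1ℚ - β) + B * ((1ℚ - ε) * γ + ε * I e n (suc μ) - β)
      ≡⟨ cong (λ z → A * (1ℚ - β) + B * (z - β)) (I-suc n μ) ⟨
    A * (1ℚ - β) + B * (I e (suc n) (suc μ) - β)          ∎
    where
    open ≤-Reasoning
    γ = I e (suc n) μ
    -- Above the level `γ` only points with `s x ≥ 1` contribute, so the recursion keeps these and
    -- lowers their `s x` by 1.
    s′ : ℕ → ℕ
    s′ x = ℕ.pred (s x)
    w′ : ℕ → ℚ
    w′ x = atLeast 1 (s x) * w x

    split : ∀ x → (I e (suc n ℕ.∸ s x) μ - β) * w x ≡ (γ - β) * (1ℚ * w x) + (I e (n ℕ.∸ s′ x) μ - γ) * w′ x
    split x with s x
    ... | zero  = solve 4 (λ g b i v → (g :- b) :* v := (g :- b) :* (con 1ℚ :* v) :+ (i :- g) :* (con 0ℚ :* v)) refl γ β (I e n μ) (w x)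
    ... | suc k = solve 4 (λ g b i v → (i :- b) :* v := (g :- b) :* (con 1ℚ :* v) :+ (i :- g) :* (con 1ℚ :* v)) refl γ β (I e (n ℕ.∸ k) μ) (w x)

    first : partialSum (λ x → (γ - β) * (1ℚ * w x)) m ≤ (γ - β) * (A + B * 1ℚ)
    first = ≤-trans (≤-reflexive (partialSum-*ˡ (γ - β) (λ x → 1ℚ * w x) m))
                    (*-mono-nonNeg (γ - β) (≤⇒0≤- β≤I) (tail 0))

    shift : ∀ t x → atLeast t (s′ x) * w′ x ≡ atLeast (suc t) (s x) * w x
    shift t x with s x
    ... | zero  = solve 2 (λ a v → a :* (con 0ℚ :* v) := con 0ℚ :* v) refl (atLeast t 0) (w x)
    ... | suc k = cong (atLeast t k *_) (*-identityˡ (w x))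

    tail′ : ∀ t → partialSum (λ x → atLeast t (s′ x) * w′ x) m ≤ A + B * ε * ε ^ t
    tail′ t = begin
      partialSum (λ x → atLeast t (s′ x) * w′ x) m       ≡⟨ partialSum-cong (shift t) m ⟩
      partialSum (λ x → atLeast (suc t) (s x) * w x) m   ≤⟨ tail (suc t) ⟩
      A + B * (ε * ε ^ t)                                ≡⟨ cong (λ z → A + z) (sym (*-assoc B ε (ε ^ t))) ⟩
      A + B * ε * ε ^ t                                  ∎

-- Integrate one prime at a time. For fixed `t₀` the joint tail bound again has the assumed form for
-- the remaining primes, with weight `w x * atLeast t₀ (s x zero)` and with `B * ε₀ ^ t₀` for `B`;
-- hence the general `w` and `B`. The outcome is a tail bound for the first prime alone, where the
-- cut-off 0 lets `A` pass unchanged.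
tail-integration-product : ∀ {ℓ} (e : Fin ℓ → OpenUnitInterval) μ m (n : Vector ℕ ℓ) A B
  (s : ℕ → Vector ℕ ℓ) (w : ℕ → ℚ) →
  (∀ (t : Vector ℕ ℓ) → partialSum (λ x → w x * product (λ j → atLeast (t j) (s x j))) m ≤
         A + B * product (λ j → OpenUnitInterval.value (e j) ^ t j)) →
  partialSum (λ x → w x * product (λ j → I (e j) (n j ℕ.∸ s x j) μ)) m ≤
  A + B * product (λ j → I (e j) (n j) (suc μ))
tail-integration-product {zero}  e μ m n A B s w tail = tail (λ ())
tail-integration-product {suc ℓ} e μ m n A B s w tail = begin
  partialSum (λ x → w x * (I e₀ (n zero ℕ.∸ s x zero) μ * rest x)) m
    ≡⟨ partialSum-cong (λ x → solve 3 (λ v i r → v :* (i :* r) := (i :- con 0ℚ) :* (v :* r)) refl (w x) (I e₀ (n zero ℕ.∸ s x zero) μ) (rest x)) m ⟩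
  partialSum (λ x → (I e₀ (n zero ℕ.∸ s x zero) μ - 0ℚ) * (w x * rest x)) m
    ≤⟨ tail-integration e₀ μ m (n zero) 0ℚ A (B * Π) (λ x → s x zero) (λ x → w x * rest x) (BetaTail.I-nonNeg e₀ (n zero) μ) tail₀ ⟩
  A * (1ℚ - 0ℚ) + B * Π * (I e₀ (n zero) (suc μ) - 0ℚ)
    ≡⟨ solve 4 (λ a b p i → a :* (con 1ℚ :- con 0ℚ) :+ b :* p :* (i :- con 0ℚ) := a :+ b :* (i :* p)) refl A B Π (I e₀ (n zero) (suc μ)) ⟩
  A + B * (I e₀ (n zero) (suc μ) * Π)   ∎
  where
  open ≤-Reasoning
  open +-*-Solver
  e₀ = e zero
  ε₀ = OpenUnitInterval.value e₀
  rest : ℕ → ℚ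
  rest x = product (λ j → I (e (suc j)) (n (suc j) ℕ.∸ s x (suc j)) μ)
  Π : ℚ
  Π = product (λ j → I (e (suc j)) (n (suc j)) (suc μ))
  tail₀ : ∀ t₀ → partialSum (λ x → atLeast t₀ (s x zero) * (w x * rest x)) m ≤ A + B * Π * ε₀ ^ t₀
  tail₀ t₀ = begin
    partialSum (λ x → atLeast t₀ (s x zero) * (w x * rest x)) m
      ≡⟨ partialSum-cong (λ x → solve 3 (λ a v r → a :* (v :* r) := v :* a :* r) refl (atLeast t₀ (s x zero)) (w x) (rest x)) m ⟩
    partialSum (λ x → w x * atLeast t₀ (s x zero) * rest x) m
      ≤⟨ tail-integration-product (e ∘ suc) μ m (n ∘ suc) A (B * ε₀ ^ t₀) (λ x → s x ∘ suc) (λ x → w x * atLeast t₀ (s x zero)) tail′ ⟩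
    A + B * ε₀ ^ t₀ * Π
      ≡⟨ solve 4 (λ a b p q → a :+ b :* q :* p := a :+ b :* p :* q) refl A B Π (ε₀ ^ t₀) ⟩
    A + B * Π * ε₀ ^ t₀  ∎
    where
    tail′ : ∀ t → partialSum (λ x → w x * atLeast t₀ (s x zero) * product (λ j → atLeast (t j) (s x (suc j)))) m ≤
                  A + B * ε₀ ^ t₀ * product (λ j → OpenUnitInterval.value (e (suc j)) ^ t j)
    tail′ t = begin
      partialSum (λ x → w x * atLeast t₀ (s x zero) * product (λ j → atLeast (t j) (s x (suc j)))) m
        ≡⟨ partialSum-cong (λ x → *-assoc (w x) (atLeast t₀ (s x zero)) _) m ⟩
      partialSum (λ x → w x * (atLeast t₀ (s x zero) * product (λ j → atLeast (t j) (s x (suc j))))) m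
        ≤⟨ tail (t₀ Vector.∷ t) ⟩
      A + B * (ε₀ ^ t₀ * product (λ j → OpenUnitInterval.value (e (suc j)) ^ t j))
        ≡⟨ cong (λ z → A + z) (sym (*-assoc B (ε₀ ^ t₀) _)) ⟩
      A + B * ε₀ ^ t₀ * product (λ j → OpenUnitInterval.value (e (suc j)) ^ t j)   ∎

-- Counting separated integers.

separated-count : ∀ {q} {Q : ℕ → Set q} D (b : ℕ → ℚ) →
  (∀ x → b x ≡ 0ℚ ⊎ (b x ≡ 1ℚ × Q x)) →
  (∀ x y → x ℕ.< y → Q x → Q y → x ℕ.+ D ℕ.≤ y) →
  ∀ m → ι D * partialSum b m ≤ ι D + ι m
separated-count {Q = Q} D b cases sep m = conclude (go m)
  where
  open +-*-Solver
  -- Each hit after the first costs a step of length at least `D`. The invariant records the last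
  -- hit `x`, with which the next one is compared.
  Count : ℕ → Set _
  Count m = partialSum b m ≡ 0ℚ ⊎ ∃ λ x → x ℕ.< m × Q x × ι D * partialSum b m ≤ ι D + ι x

  go : ∀ m → Count m
  go zero    = inj₁ refl
  go (suc m) with cases m | go m
  ... | inj₁ b≡0        | inj₁ S≡0 = inj₁ (cong₂ _+_ S≡0 b≡0)
  ... | inj₁ b≡0        | inj₂ (x , x<m , Qx , le) = inj₂ (x , ℕ.m≤n⇒m≤1+n x<m , Qx ,
    subst (λ z → ι D * z ≤ ι D + ι x) (sym (trans (cong (λ z → partialSum b m + z) b≡0) (+-identityʳ (partialSum b m)))) le)
  ... | inj₂ (b≡1 , Qm) | inj₁ S≡0 = inj₂ (m , ℕ.≤-refl , Qm , (begin
    ι D * (partialSum b m + b m)   ≡⟨ cong (ι D *_) (cong₂ _+_ S≡0 b≡1) ⟩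
    ι D * (0ℚ + 1ℚ)                ≡⟨ solve 1 (λ d → d :* (con 0ℚ :+ con 1ℚ) := d :+ con 0ℚ) refl (ι D) ⟩
    ι D + 0ℚ                       ≤⟨ +-monoʳ-≤ (ι D) (0≤ι m) ⟩
    ι D + ι m                      ∎))
    where open ≤-Reasoning
  ... | inj₂ (b≡1 , Qm) | inj₂ (x , x<m , Qx , le) = inj₂ (m , ℕ.≤-refl , Qm , (begin
    ι D * (partialSum b m + b m)   ≡⟨ cong (λ z → ι D * (partialSum b m + z)) b≡1 ⟩
    ι D * (partialSum b m + 1ℚ)    ≡⟨ solve 2 (λ d s → d :* (s :+ con 1ℚ) := d :+ d :* s) refl (ι D) (partialSum b m) ⟩
    ι D + ι D * partialSum b m     ≤⟨ +-monoʳ-≤ (ι D) le ⟩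
    ι D + (ι D + ι x)              ≡⟨ cong (λ z → ι D + z) (trans (+-comm (ι D) (ι x)) (sym (ι-+ x D))) ⟩
    ι D + ι (x ℕ.+ D)              ≤⟨ +-monoʳ-≤ (ι D) (ι-mono (sep x m x<m Qx Qm)) ⟩
    ι D + ι m                      ∎))
    where open ≤-Reasoning

  conclude : ∀ {m} → Count m → ι D * partialSum b m ≤ ι D + ι m
  conclude {m} (inj₁ S≡0) = ≤-trans (≤-reflexive (trans (cong (ι D *_) S≡0) (*-zeroʳ (ι D)))) (+-mono-≤ (0≤ι D) (0≤ι m))
  conclude (inj₂ (x , x<m , _ , le)) = ≤-trans le (+-monoʳ-≤ (ι D) (ι-mono (ℕ.<⇒≤ x<m)))

-- Divisibility by prime powers.

infix 4 _∣ℤ_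
_∣ℤ_ : ℕ → ℤ → Set
d ∣ℤ i = + d ℤ.∣ i

^-monoʳ-∣ : ∀ p {k n} → k ℕ.≤ n → p ℕ.^ k ∣ p ℕ.^ n
^-monoʳ-∣ p {k} {n} k≤n = divides (p ℕ.^ (n ℕ.∸ k))
  (trans (cong (p ℕ.^_) (sym (ℕ.m∸n+n≡m k≤n))) (ℕ.^-distribˡ-+-* p (n ℕ.∸ k) k))

-- Euclid's lemma moves the factors `p` into `y` one at a time, and each is then cancelled on both
-- sides.
prime-power-∣-cancel : ∀ {p} → Prime p → ∀ t {y c} → p ∤ c → p ℕ.^ t ∣ y ℕ.* c → p ℕ.^ t ∣ y
prime-power-∣-cancel p-prime zero {y} p∤c _ = ℕ.1∣ y
prime-power-∣-cancel {p} p-prime (suc t) {y} {c} p∤c d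
  with euclidsLemma y c p-prime (ℕ.∣-trans (ℕ.m∣m*n (p ℕ.^ t)) d)
... | inj₂ p∣c = contradiction p∣c p∤c
... | inj₁ (divides y′ refl) = subst (p ℕ.* p ℕ.^ t ∣_) (ℕ.*-comm p y′)
  (ℕ.*-monoʳ-∣ p (prime-power-∣-cancel p-prime t p∤c
    (ℕ.*-cancelˡ-∣ p {{prime⇒nonZero p-prime}} (subst (p ℕ.* p ℕ.^ t ∣_) assoc d))))
  where
  assoc : y′ ℕ.* p ℕ.* c ≡ p ℕ.* (y′ ℕ.* c)
  assoc = trans (cong (ℕ._* c) (ℕ.*-comm y′ p)) (ℕ.*-assoc p y′ c)

-- At most `a` of the `a + t` factors `p` can come from `c`. The induction strips `p` from `c` and
-- lowers `a` until `p ∤ c`.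
valuation-cancel : ∀ {p} → Prime p → ∀ a t {y c} →
  p ℕ.^ (a ℕ.+ t) ∣ y ℕ.* c → p ℕ.^ suc a ∤ c → p ℕ.^ t ∣ y
valuation-cancel {p} p-prime a t {y} {c} d nd with p ∣? c
... | no p∤c = ℕ.∣-trans
  (^-monoʳ-∣ p (ℕ.m≤n+m t a))
  (prime-power-∣-cancel p-prime (a ℕ.+ t) p∤c d)
valuation-cancel {p} p-prime zero t d nd | yes p∣c =
  contradiction (subst (_∣ _) (sym (ℕ.*-identityʳ p)) p∣c) nd
valuation-cancel {p} p-prime (suc a) t {y} d nd | yes (divides c′ refl) =
  valuation-cancel p-prime a t
    (ℕ.*-cancelˡ-∣ p {{prime⇒nonZero p-prime}} (subst (p ℕ.* p ℕ.^ (a ℕ.+ t) ∣_) swap d))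
    λ d′ → nd (subst (p ℕ.* p ℕ.^ suc a ∣_) (ℕ.*-comm p c′) (ℕ.*-monoʳ-∣ p d′))
  where
  swap : y ℕ.* (c′ ℕ.* p) ≡ p ℕ.* (y ℕ.* c′)
  swap = trans (sym (ℕ.*-assoc y c′ p)) (ℕ.*-comm (y ℕ.* c′) p)

prime-∣-power : ∀ {p q} → Prime p → ∀ t → p ∣ q ℕ.^ t → p ∣ q
prime-∣-power p-prime zero p∣1 =
  contradiction (subst Prime (ℕ.∣1⇒≡1 p∣1) p-prime) ¬prime[1]
prime-∣-power {q = q} p-prime (suc t) d with euclidsLemma q (q ℕ.^ t) p-prime d
... | inj₁ p∣q  = p∣q
... | inj₂ p∣q^ = prime-∣-power p-prime t p∣q^

prime-∣-prime : ∀ {p q} → Prime p → Prime q → p ∣ q → p ≡ q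
prime-∣-prime p-prime q-prime p∣q with prime⇒irreducible q-prime p∣q
... | inj₁ refl = contradiction p-prime ¬prime[1]
... | inj₂ p≡q  = p≡q

prime-∤-product : ∀ {ℓ p} (q t : Vector ℕ ℓ) → Prime p → (∀ j → Prime (q j)) → (∀ j → p ≢ q j) →
  p ∤ productℕ (λ j → q j ℕ.^ t j)
prime-∤-product {zero}  q t p-prime q-prime p≢q p∣1 =
  ¬prime[1] (subst Prime (ℕ.∣1⇒≡1 p∣1) p-prime)
prime-∤-product {suc ℓ} q t p-prime q-prime p≢q p∣
  with euclidsLemma (q zero ℕ.^ t zero) _ p-prime p∣
... | inj₁ p∣q^ = p≢q zero (prime-∣-prime p-prime (q-prime zero) (prime-∣-power p-prime (t zero) p∣q^))
... | inj₂ p∣Π  = prime-∤-product (q ∘ suc) (t ∘ suc) p-prime (q-prime ∘ suc) (p≢q ∘ suc) p∣Π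

-- The prime `p zero` does not divide the product of the other prime powers, so its power must
-- divide the cofactor `k` of that product in `z`.
prime-powers-∣ : ∀ {ℓ} (p t : Vector ℕ ℓ) → (∀ j → Prime (p j)) → Injective _≡_ _≡_ p →
  ∀ {z} → (∀ j → p j ℕ.^ t j ∣ z) → productℕ (λ j → p j ℕ.^ t j) ∣ z
prime-powers-∣ {zero}  p t p-prime p-inj {z} _ = ℕ.1∣ z
prime-powers-∣ {suc ℓ} p t p-prime p-inj d
  with prime-powers-∣ (p ∘ suc) (t ∘ suc) (p-prime ∘ suc) (Fin.suc-injective ∘ p-inj) (d ∘ suc)
... | divides k refl = ℕ.*-monoˡ-∣ _ (prime-power-∣-cancel (p-prime zero) (t zero) {y = k}
  (prime-∤-product (p ∘ suc) (t ∘ suc) (p-prime zero) (p-prime ∘ suc) (λ j eq → Fin.0≢1+n (p-inj eq)))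
  (d zero))

-- Multiaffine polynomials and divisibility of their content.

-- Degree at most 1 is built into the syntax (`g +X· h` is g + X h), so substituting for the leading
-- variable stays inside the type with no degree condition to carry along.
data Multiaffine : ℕ → Set where
  constant : ℤ → Multiaffine 0
  _+X·_    : ∀ {μ} → Multiaffine μ → Multiaffine μ → Multiaffine (suc μ)

evalᴹ : ∀ {μ} → Multiaffine μ → Vec ℤ μ → ℤ
evalᴹ (constant c) []       = c
evalᴹ (g +X· h)    (x ∷ xs) = evalᴹ g xs ℤ.+ x ℤ.* evalᴹ h xs

infix 4 _∣ᶜ_ _∣ᶜ?_
-- Divisibility of the content, taken coefficient by coefficient so that no gcd has to be formed.
_∣ᶜ_ : ∀ {μ} → ℕ → Multiaffine μ → Set
d ∣ᶜ constant c = d ∣ℤ c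
d ∣ᶜ (g +X· h)  = d ∣ᶜ g × d ∣ᶜ h

_∣ᶜ?_ : ∀ {μ} d (T : Multiaffine μ) → Dec (d ∣ᶜ T)
d ∣ᶜ? constant c = + d ℤ.∣? c
d ∣ᶜ? (g +X· h)  = (d ∣ᶜ? g) ×-dec (d ∣ᶜ? h)

_+⟨_⟩·_ : ∀ {μ} → Multiaffine μ → ℤ → Multiaffine μ → Multiaffine μ
constant c +⟨ x ⟩· constant d  = constant (c ℤ.+ x ℤ.* d)
(g +X· g′) +⟨ x ⟩· (h +X· h′) = (g +⟨ x ⟩· h) +X· (g′ +⟨ x ⟩· h′)

evalᴹ-+⟨⟩· : ∀ {μ} (g h : Multiaffine μ) x xs → evalᴹ (g +⟨ x ⟩· h) xs ≡ evalᴹ g xs ℤ.+ x ℤ.* evalᴹ h xs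
evalᴹ-+⟨⟩· (constant c) (constant d) x []       = refl
evalᴹ-+⟨⟩· (g +X· g′)   (h +X· h′)   x (y ∷ ys) =
  trans (cong₂ (λ u v → u ℤ.+ y ℤ.* v) (evalᴹ-+⟨⟩· g h x ys) (evalᴹ-+⟨⟩· g′ h′ x ys))
        (rearrange (evalᴹ g ys) (evalᴹ h ys) (evalᴹ g′ ys) (evalᴹ h′ ys) x y)
  where
  rearrange : ∀ a b c d x y → a ℤ.+ x ℤ.* b ℤ.+ y ℤ.* (c ℤ.+ x ℤ.* d) ≡ a ℤ.+ y ℤ.* c ℤ.+ x ℤ.* (b ℤ.+ y ℤ.* d)
  rearrange = solve-∀

∣ᶜ-+⟨⟩·-∣ᶜ : ∀ {μ d} (g h : Multiaffine μ) x → d ∣ᶜ (g +⟨ x ⟩· h) → d ∣ᶜ h → d ∣ᶜ g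
∣ᶜ-+⟨⟩·-∣ᶜ (constant c) (constant d) x s t = ℤ.∣m+n∣n⇒∣m s (ℤ.∣n⇒∣m*n x t)
∣ᶜ-+⟨⟩·-∣ᶜ (g +X· g′) (h +X· h′) x (s , s′) (t , t′) = ∣ᶜ-+⟨⟩·-∣ᶜ g h x s t , ∣ᶜ-+⟨⟩·-∣ᶜ g′ h′ x s′ t′

-- Some coefficient `d` of `h` has at most `a` factors `p`; at its place the two polynomials differ
-- by `(x - y) * d`, and `valuation-cancel` applies. The recursion searches for this coefficient.
∣ᶜ-+⟨⟩·-difference : ∀ {p} → Prime p → ∀ a t {μ} (g h : Multiaffine μ) x y → ¬ p ℕ.^ suc a ∣ᶜ h →
  p ℕ.^ (a ℕ.+ t) ∣ᶜ (g +⟨ x ⟩· h) → p ℕ.^ (a ℕ.+ t) ∣ᶜ (g +⟨ y ⟩· h) → p ℕ.^ t ∣ ℤ.∣ x ℤ.- y ∣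
∣ᶜ-+⟨⟩·-difference {p} p-prime a t (constant c) (constant d) x y nd dx dy =
  valuation-cancel p-prime a t
    (subst (p ℕ.^ (a ℕ.+ t) ∣_) (ℤ.abs-* (x ℤ.- y) d)
      (ℤ.∣⇒∣ᵤ (subst (p ℕ.^ (a ℕ.+ t) ∣ℤ_) (factor c d x y) (ℤ.∣m∣n⇒∣m-n dx dy))))
    (nd ∘ ℤ.∣ᵤ⇒∣)
  where
  factor : ∀ c d x y → c ℤ.+ x ℤ.* d ℤ.- (c ℤ.+ y ℤ.* d) ≡ (x ℤ.- y) ℤ.* d
  factor = solve-∀
∣ᶜ-+⟨⟩·-difference {p} p-prime a t (g +X· g′) (h +X· h′) x y nd (dx , dx′) (dy , dy′)
  with p ℕ.^ suc a ∣ᶜ? h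
... | no  ∤h = ∣ᶜ-+⟨⟩·-difference p-prime a t g h x y ∤h dx dy
... | yes ∣h = ∣ᶜ-+⟨⟩·-difference p-prime a t g′ h′ x y (λ ∣h′ → nd (∣h , ∣h′)) dx′ dy′

-- Passing from `Poly` to multiaffine form.

0ᴹ : ∀ {μ} → Multiaffine μ
0ᴹ {zero}  = constant ℤ.0ℤ
0ᴹ {suc μ} = 0ᴹ +X· 0ᴹ

evalᴹ-0ᴹ : ∀ {μ} (xs : Vec ℤ μ) → evalᴹ 0ᴹ xs ≡ ℤ.0ℤ
evalᴹ-0ᴹ []       = refl
evalᴹ-0ᴹ (x ∷ xs) = cong₂ ℤ._+_ (evalᴹ-0ᴹ xs) (trans (cong (x ℤ.*_) (evalᴹ-0ᴹ xs)) (ℤ.*-zeroʳ x))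

-- Entries of degree 2 and higher are discarded. For multilinear `f` all their coefficients are zero
-- (`multilinear-rest`), so values and common divisors of the coefficients survive.
multiaffine : ∀ {μ} → Poly μ → Multiaffine μ
multiaffine (const c)          = constant c
multiaffine (poly [])          = 0ᴹ +X· 0ᴹ
multiaffine (poly (a ∷ []))    = multiaffine a +X· 0ᴹ
multiaffine (poly (a ∷ b ∷ _)) = multiaffine a +X· multiaffine b

mutual
  coeffs-All : ∀ {q} {P : Pred ℤ q} {μ} (f : Poly μ) → (∀ e → P (coeff f e)) → All P (coeffs f)
  coeffs-All (const c) Pc = Pc [] ∷ []
  coeffs-All (poly as) Pc = coeffsOf-All as (λ e es → Pc (e ∷ es))

  coeffsOf-All : ∀ {q} {P : Pred ℤ q} {μ} (as : List (Poly μ)) → (∀ e es → P (coeffAt as e es)) → All P (coeffsOf as)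
  coeffsOf-All []       Pc = []
  coeffsOf-All (a ∷ as) Pc = All.++⁺ (coeffs-All a (Pc 0)) (coeffsOf-All as (Pc ∘ suc))

mutual
  eval-zero : ∀ {μ} (f : Poly μ) → All (_≡ ℤ.0ℤ) (coeffs f) → ∀ xs → eval f xs ≡ ℤ.0ℤ
  eval-zero (const c) (c≡0 ∷ []) []       = c≡0
  eval-zero (poly as) all≡0      (x ∷ xs) = horner-zero as all≡0 x xs

  horner-zero : ∀ {μ} (as : List (Poly μ)) → All (_≡ ℤ.0ℤ) (coeffsOf as) → ∀ x xs → horner as x xs ≡ ℤ.0ℤ
  horner-zero []       _     x xs = refl
  horner-zero (a ∷ as) all≡0 x xs = cong₂ ℤ._+_
    (eval-zero a (All.++⁻ˡ (coeffs a) all≡0) xs)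
    (trans (cong (x ℤ.*_) (horner-zero as (All.++⁻ʳ (coeffs a) all≡0) x xs)) (ℤ.*-zeroʳ x))

multilinear-head : ∀ {μ} {a : Poly μ} {as} → Multilinear (poly (a ∷ as)) → Multilinear a
multilinear-head ml e c≢0 i = ml (0 ∷ e) c≢0 (suc i)

multilinear-second : ∀ {μ} {a b : Poly μ} {as} → Multilinear (poly (a ∷ b ∷ as)) → Multilinear b
multilinear-second ml e c≢0 i = ml (1 ∷ e) c≢0 (suc i)

multilinear-rest : ∀ {μ} {a b : Poly μ} {as} → Multilinear (poly (a ∷ b ∷ as)) →
  All (_≡ ℤ.0ℤ) (coeffsOf as)
multilinear-rest {as = as} ml = coeffsOf-All as λ e es →
  -- `Multilinear` only refutes a nonzero coefficient; decidable equality on ℤ turns this into being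
  -- zero.
  decidable-stable (coeffAt as e es ℤ.≟ ℤ.0ℤ) λ c≢0 →
    contradiction (ml (suc (suc e) ∷ es) c≢0 zero) λ { (s≤s ()) }

evalᴹ-multiaffine : ∀ {μ} (f : Poly μ) → Multilinear f → ∀ xs → evalᴹ (multiaffine f) xs ≡ eval f xs
evalᴹ-multiaffine (const c) ml [] = refl
evalᴹ-multiaffine (poly []) ml (x ∷ xs) = evalᴹ-0ᴹ (x ∷ xs)
evalᴹ-multiaffine (poly (a ∷ [])) ml (x ∷ xs) =
  cong₂ (λ u v → u ℤ.+ x ℤ.* v) (evalᴹ-multiaffine a (multilinear-head {a = a} ml) xs) (evalᴹ-0ᴹ xs)
evalᴹ-multiaffine (poly (a ∷ b ∷ as)) ml (x ∷ xs) =
  cong₂ (λ u v → u ℤ.+ x ℤ.* v)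
    (evalᴹ-multiaffine a (multilinear-head {a = a} ml) xs)
    (begin
      evalᴹ (multiaffine b) xs              ≡⟨ evalᴹ-multiaffine b (multilinear-second {a = a} {b} ml) xs ⟩
      eval b xs                             ≡⟨ ℤ.+-identityʳ (eval b xs) ⟨
      eval b xs ℤ.+ ℤ.0ℤ                    ≡⟨ cong (λ z → eval b xs ℤ.+ z) (ℤ.*-zeroʳ x) ⟨
      eval b xs ℤ.+ x ℤ.* ℤ.0ℤ              ≡⟨ cong (λ z → eval b xs ℤ.+ x ℤ.* z) (horner-zero as (multilinear-rest {a = a} {b} ml) x xs) ⟨
      eval b xs ℤ.+ x ℤ.* horner as x xs    ∎)
  where open ≡-Reasoning

∣ᶜ-multiaffine : ∀ {μ d} (f : Poly μ) → Multilinear f → d ∣ᶜ multiaffine f → All (d ∣ℤ_) (coeffs f)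
∣ᶜ-multiaffine (const c) ml d∣ = d∣ ∷ []
∣ᶜ-multiaffine (poly []) ml d∣ = []
∣ᶜ-multiaffine (poly (a ∷ [])) ml (d∣ , _) =
  All.++⁺ (∣ᶜ-multiaffine a (multilinear-head {a = a} ml) d∣) []
∣ᶜ-multiaffine {d = d} (poly (a ∷ b ∷ as)) ml (d∣ , d∣′) =
  All.++⁺ (∣ᶜ-multiaffine a (multilinear-head {a = a} ml) d∣)
  (All.++⁺ (∣ᶜ-multiaffine b (multilinear-second {a = a} {b} ml) d∣′)
  (All.map (λ { refl → ℤ.∣ᵤ⇒∣ (d ℕ.∣0) }) (multilinear-rest {a = a} {b} ml)))

∣-gcds : ∀ {d N} cs → d ∣ N → All (d ∣ℤ_) cs → d ∣ foldr (λ c g → gcd ℤ.∣ c ∣ g) N cs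
∣-gcds []       d∣N []          = d∣N
∣-gcds (c ∷ cs) d∣N (d∣c ∷ d∣cs) = gcd-greatest (ℤ.∣⇒∣ᵤ d∣c) (∣-gcds cs d∣N d∣cs)

-- Counting in the cube, capped valuations and reciprocals.

length-filter-map : ∀ {a b q} {A : Set a} {B : Set b} {P : Pred B q} (P? : Decidable P) (f : A → B) xs →
  length (filter P? (map f xs)) ≡ length (filter (P? ∘ f) xs)
length-filter-map P? f []       = refl
length-filter-map P? f (x ∷ xs) with does (P? (f x))
... | true  = cong suc (length-filter-map P? f xs)
... | false = length-filter-map P? f xs

-- Groups the points by first coordinate; `upTo` is split at its last element to match `partialSum`.
length-filter-product : ∀ {b c q} {B : Set b} {C : Set c} {P : Pred C q} (P? : Decidable P) (f : ℕ → B → C) ys m →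
  ι (length (filter P? (cartesianProductWith f (upTo m) ys))) ≡
  partialSum (λ x → ι (length (filter (P? ∘ f x) ys))) m
length-filter-product P? f ys zero    = refl
length-filter-product P? f ys (suc m) = begin
  ι (count (prod (upTo (suc m))))                          ≡⟨ cong (ι ∘ count ∘ prod) (upTo-∷ʳ m) ⟨
  ι (count (prod (upTo m ++ m ∷ [])))                      ≡⟨ cong (ι ∘ count) (cartesianProductWith-distribʳ-++ f (upTo m) (m ∷ []) ys) ⟩
  ι (count (prod (upTo m) ++ map (f m) ys ++ []))          ≡⟨ cong (λ zs → ι (count (prod (upTo m) ++ zs))) (++-identityʳ (map (f m) ys)) ⟩
  ι (count (prod (upTo m) ++ map (f m) ys))                ≡⟨ cong (ι ∘ length) (filter-++ P? (prod (upTo m)) (map (f m) ys)) ⟩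
  ι (length (filter P? (prod (upTo m)) ++ filter P? (map (f m) ys)))
    ≡⟨ cong ι (length-++ (filter P? (prod (upTo m)))) ⟩
  ι (count (prod (upTo m)) ℕ.+ count (map (f m) ys))       ≡⟨ ι-+ (count (prod (upTo m))) (count (map (f m) ys)) ⟩
  ι (count (prod (upTo m))) + ι (count (map (f m) ys))     ≡⟨ cong₂ _+_ (length-filter-product P? f ys m) (cong ι (length-filter-map P? (f m) ys)) ⟩
  partialSum (λ x → ι (length (filter (P? ∘ f x) ys))) m + ι (length (filter (P? ∘ f m) ys))   ∎
  where
  open ≡-Reasoning
  count = length ∘ filter P?
  prod : List ℕ → List _
  prod ns = cartesianProductWith f ns ys

-- A search for the first failure of `R`, capped at `n`. With `R` as divisibility by successive
-- prime powers, `s` is the capped gain in valuation.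
climb : ∀ {q} {R : Pred ℕ q} → Decidable R → ∀ n →
  ∃ λ s → s ℕ.≤ n × (n ℕ.∸ s ≡ 0 ⊎ ¬ R s) × (∀ {t} → t ℕ.< s → R t)
climb R? zero = 0 , z≤n , inj₁ refl , λ ()
climb R? (suc n) with R? 0
... | no ¬R0 = 0 , z≤n , inj₂ ¬R0 , λ ()
... | yes R0 with climb (R? ∘ suc) n
...   | s , s≤n , stop , below =
  suc s , s≤s s≤n , stop , λ { {zero} _ → R0 ; {suc t} (s≤s t<s) → below t<s }

^-inverse : ∀ {q} d → q * ι d ≡ 1ℚ → ∀ t → q ^ t * ι (d ℕ.^ t) ≡ 1ℚ
^-inverse d inv zero    = refl
^-inverse {q} d inv (suc t) = begin
  q * q ^ t * ι (d ℕ.* d ℕ.^ t)        ≡⟨ cong (q * q ^ t *_) (ι-* d (d ℕ.^ t)) ⟩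
  q * q ^ t * (ι d * ι (d ℕ.^ t))      ≡⟨ solve 4 (λ a b x y → a :* b :* (x :* y) := a :* x :* (b :* y)) refl q (q ^ t) (ι d) (ι (d ℕ.^ t)) ⟩
  q * ι d * (q ^ t * ι (d ℕ.^ t))      ≡⟨ cong₂ _*_ inv (^-inverse d inv t) ⟩
  1ℚ                                   ∎
  where open ≡-Reasoning
        open +-*-Solver

product-inverse : ∀ {ℓ} (q : Vector ℚ ℓ) (d t : Vector ℕ ℓ) → (∀ j → q j * ι (d j) ≡ 1ℚ) →
  product (λ j → q j ^ t j) * ι (productℕ (λ j → d j ℕ.^ t j)) ≡ 1ℚ
product-inverse {zero}  q d t inv = refl
product-inverse {suc ℓ} q d t inv = begin
  q₀ * Q * ι (d₀ ℕ.* D)      ≡⟨ cong (q₀ * Q *_) (ι-* d₀ D) ⟩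
  q₀ * Q * (ι d₀ * ι D)      ≡⟨ solve 4 (λ a b x y → a :* b :* (x :* y) := a :* x :* (b :* y)) refl q₀ Q (ι d₀) (ι D) ⟩
  q₀ * ι d₀ * (Q * ι D)      ≡⟨ cong₂ _*_ (^-inverse (d zero) (inv zero) (t zero)) (product-inverse (q ∘ suc) (d ∘ suc) (t ∘ suc) (inv ∘ suc)) ⟩
  1ℚ                         ∎
  where
  open ≡-Reasoning
  open +-*-Solver
  q₀ = q zero ^ t zero
  d₀ = d zero ℕ.^ t zero
  Q = product (λ j → q (suc j) ^ t (suc j))
  D = productℕ (λ j → d (suc j) ℕ.^ t (suc j))

∣+y-+x∣ : ∀ {x y} → x ℕ.≤ y → ℤ.∣ + y ℤ.- + x ∣ ≡ y ℕ.∸ x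
∣+y-+x∣ {x} {y} x≤y = cong ℤ.∣_∣ (trans (ℤ.m-n≡m⊖n y x) (ℤ.⊖-≥ x≤y))

-- Induction on the number of variables.

module _ {ℓ} (p : Vector ℕ ℓ) (p-prime : ∀ j → Prime (p j)) (p-inj : Injective _≡_ _≡_ p) (m : ℕ) where

  ε : Fin ℓ → OpenUnitInterval
  ε j = reciprocal (p-prime j)

  ε-value : Fin ℓ → ℚ
  ε-value j = OpenUnitInterval.value (ε j)

  -- Writing the target exponent of p j as a j + n j, where a j is (at least) the
  -- valuation of the content of T unless n j = 0, avoids dividing T by its content.
  vanishing-count : ∀ μ (T : Multiaffine μ) (a n : Vector ℕ ℓ) →
    (∀ j → n j ≡ 0 ⊎ ¬ p j ℕ.^ suc (a j) ∣ᶜ T) →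
    ∀ {q} {P : Pred (Vec ℤ μ) q} (P? : Decidable P) →
    (∀ {xs} → P xs → ∀ j → p j ℕ.^ (a j ℕ.+ n j) ∣ℤ evalᴹ T xs) →
    ι m * ι (length (filter P? (cube m μ))) ≤ ι m ^ μ * (ι μ + ι m * product (λ j → I (ε j) (n j) μ))
  vanishing-count zero (constant c) a n exhausted P? P⇒∣ with Fin.all? (λ j → n j ℕ.≟ 0)
  -- Every factor `I` is 1, which leaves room for the single point of the cube.
  ... | yes n≡0 = begin
    ι m * ι (length (filter P? ([] ∷ [])))                   ≤⟨ *-mono-nonNeg (ι m) (0≤ι m) (ι-mono (length-filter P? ([] ∷ []))) ⟩
    ι m * 1ℚ                                                 ≡⟨ cong (ι m *_) (product-ones _ I≡1) ⟨
    ι m * product (λ j → I (ε j) (n j) 0)                    ≡⟨ solve 1 (λ x → x := con 1ℚ :* (con 0ℚ :+ x)) refl (ι m * product (λ j → I (ε j) (n j) 0)) ⟩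
    1ℚ * (0ℚ + ι m * product (λ j → I (ε j) (n j) 0))        ∎
    where
    open ≤-Reasoning
    open +-*-Solver
    I≡1 : ∀ j → I (ε j) (n j) 0 ≡ 1ℚ
    I≡1 j = trans (cong (λ k → I (ε j) k 0) (n≡0 j)) (BetaTail.I-zeroˡ (ε j) 0)
  -- Some `n j` is positive, so `c` would need more factors `p j` than it has: no point is counted.
  ... | no ¬n≡0 = ≤-trans
    (≤-reflexive (trans (cong (λ zs → ι m * ι (length zs)) (filter-reject P? {[]} {[]} ¬P)) (*-zeroʳ (ι m))))
    (*-nonNeg (0≤ι 1) (+-mono-≤ (0≤ι 0) (*-nonNeg (0≤ι m) (product-nonNeg _ λ j → BetaTail.I-nonNeg (ε j) (n j) 0))))
    where
    ¬P : ¬ _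
    ¬P P[] with Fin.¬∀⟶∃¬ ℓ _ (λ j → n j ℕ.≟ 0) ¬n≡0
    ... | j , nj≢0 with exhausted j
    ...   | inj₁ nj≡0 = nj≢0 nj≡0
    ...   | inj₂ p∤c  = p∤c (ℤ.∣-trans (ℤ.∣ᵤ⇒∣ p^∣p^) (P⇒∣ P[] j))
      where
      p^∣p^ : p j ℕ.^ suc (a j) ∣ p j ℕ.^ (a j ℕ.+ n j)
      p^∣p^ = ^-monoʳ-∣ (p j) (subst (ℕ._≤ a j ℕ.+ n j) (ℕ.+-comm (a j) 1) (ℕ.+-monoʳ-≤ (a j) (ℕ.n≢0⇒n>0 nj≢0)))
  vanishing-count (suc μ) T@(g +X· h) a n exhausted P? P⇒∣ = begin
    ι m * ι (length (filter P? (cube m (suc μ))))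
      ≡⟨ cong (ι m *_) (length-filter-product P? (λ x xs → + x ∷ xs) (cube m μ) m) ⟩
    ι m * partialSum count m
      ≡⟨ partialSum-*ˡ (ι m) count m ⟨
    partialSum (λ x → ι m * count x) m
      ≤⟨ partialSum-mono slice m ⟩
    partialSum (λ x → ι m ^ μ * (ι μ + ι m * Π x)) m
      ≡⟨ partialSum-*ˡ (ι m ^ μ) (λ x → ι μ + ι m * Π x) m ⟩
    ι m ^ μ * partialSum (λ x → ι μ + ι m * Π x) m
      ≡⟨ cong (ι m ^ μ *_) (trans (partialSum-+ (λ _ → ι μ) (λ x → ι m * Π x) m)
           (cong₂ _+_ (partialSum-const (ι μ) m)
             (trans (partialSum-*ˡ (ι m) Π m) (cong (ι m *_) (partialSum-cong (λ x → sym (*-identityˡ (Π x))) m))))) ⟩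
    ι m ^ μ * (ι m * ι μ + ι m * partialSum (λ x → 1ℚ * Π x) m)
      -- `A = 1` and `B = m`: tails count points out of `m`, so an error of 1 is a probability of
      -- 1/m. It turns `ι μ` into `ι (suc μ)`.
      ≤⟨ *-mono-nonNeg (ι m ^ μ) (^-nonNeg (0≤ι m) μ) (+-monoʳ-≤ (ι m * ι μ) (*-mono-nonNeg (ι m) (0≤ι m)
           (tail-integration-product ε μ m n 1ℚ (ι m) climbed (λ _ → 1ℚ) tail))) ⟩
    ι m ^ μ * (ι m * ι μ + ι m * (1ℚ + ι m * Π′))
      ≡⟨ solve 4 (λ t x u v → t :* (x :* u :+ x :* (con 1ℚ :+ x :* v)) := x :* t :* (con 1ℚ :+ u :+ x :* v)) refl (ι m ^ μ) (ι m) (ι μ) Π′ ⟩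
    ι m * ι m ^ μ * (1ℚ + ι μ + ι m * Π′)
      ≡⟨ cong (λ z → ι m * ι m ^ μ * (z + ι m * Π′)) (ι-+ 1 μ) ⟨
    ι m ^ suc μ * (ι (suc μ) + ι m * Π′)  ∎
    where
    open ≤-Reasoning
    open +-*-Solver
    slice? : ∀ x → Decidable _
    slice? x xs = P? (+ x ∷ xs)

    count : ℕ → ℚ
    count x = ι (length (filter (slice? x) (cube m μ)))

    T[_] : ℕ → Multiaffine μ
    T[ x ] = g +⟨ + x ⟩· h

    gain : ∀ x j → ∃ λ s → s ℕ.≤ n j × (n j ℕ.∸ s ≡ 0 ⊎ ¬ p j ℕ.^ suc (a j ℕ.+ s) ∣ᶜ T[ x ]) ×
                           (∀ {t} → t ℕ.< s → p j ℕ.^ suc (a j ℕ.+ t) ∣ᶜ T[ x ])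
    gain x j = climb (λ t → p j ℕ.^ suc (a j ℕ.+ t) ∣ᶜ? T[ x ]) (n j)

    climbed : ℕ → Vector ℕ ℓ
    climbed x j = proj₁ (gain x j)

    Π : ℕ → ℚ
    Π x = product (λ j → I (ε j) (n j ℕ.∸ climbed x j) μ)
    Π′ : ℚ
    Π′ = product (λ j → I (ε j) (n j) (suc μ))

    slice : ∀ x → ι m * count x ≤ ι m ^ μ * (ι μ + ι m * Π x)
    -- The gained exponent `climbed x j` moves from `n j` to `a j`, leaving the target `a j + n j`
    -- unchanged.
    slice x = vanishing-count μ T[ x ] (λ j → a j ℕ.+ climbed x j) (λ j → n j ℕ.∸ climbed x j)
      (λ j → proj₁ (proj₂ (proj₂ (gain x j)))) (slice? x)
      λ {xs} Pxs j → subst₂ (λ k z → p j ℕ.^ k ∣ℤ z)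
        (sym (trans (ℕ.+-assoc (a j) (climbed x j) _) (cong (a j ℕ.+_) (ℕ.m+[n∸m]≡n (proj₁ (proj₂ (gain x j)))))))
        (sym (evalᴹ-+⟨⟩· g h (+ x) xs)) (P⇒∣ Pxs j)

    ∣-difference : ∀ t x y j → t ℕ.≤ climbed x j → t ℕ.≤ climbed y j → p j ℕ.^ t ∣ ℤ.∣ + y ℤ.- + x ∣
    -- Exponent 0 is split off because `∤h` below relies on at least one factor being gained at `x`.
    ∣-difference zero    x y j _ _ = ℕ.1∣ _
    ∣-difference (suc t) x y j t<sx t<sy =
      ∣ᶜ-+⟨⟩·-difference (p-prime j) (a j) (suc t) g h (+ y) (+ x) ∤h (at y t<sy) (at x t<sx)
      where
      at : ∀ z → suc t ℕ.≤ climbed z j → p j ℕ.^ (a j ℕ.+ suc t) ∣ᶜ T[ z ]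
      at z t<s = subst (λ k → p j ℕ.^ k ∣ᶜ T[ z ]) (sym (ℕ.+-suc (a j) t)) (proj₂ (proj₂ (proj₂ (gain z j))) t<s)
      at₀ : p j ℕ.^ suc (a j) ∣ᶜ T[ x ]
      at₀ = subst (λ k → p j ℕ.^ suc k ∣ᶜ T[ x ]) (ℕ.+-identityʳ (a j))
        (proj₂ (proj₂ (proj₂ (gain x j))) (ℕ.≤-trans (s≤s z≤n) t<sx))
      -- A power dividing both `h` and `g + x h` would divide `g`, hence `T`, against `exhausted`;
      -- its alternative `n j = 0` leaves no room for a gain.
      ∤h : ¬ p j ℕ.^ suc (a j) ∣ᶜ h
      ∤h ∣h with exhausted j
      ... | inj₁ nj≡0 = ℕ.<⇒≱ (ℕ.≤-trans t<sx (proj₁ (proj₂ (gain x j)))) (ℕ.≤-trans (ℕ.≤-reflexive nj≡0) z≤n)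
      ... | inj₂ ∤T   = ∤T (∣ᶜ-+⟨⟩·-∣ᶜ g h (+ x) at₀ ∣h , ∣h)

    -- Points with joint gains `t` lie at least `D` apart, so there are at most 1 + m / D of them,
    -- and `E` is 1 / D.
    tail : ∀ (t : Vector ℕ ℓ) → partialSum (λ x → 1ℚ * product (λ j → atLeast (t j) (climbed x j))) m ≤
           1ℚ + ι m * product (λ j → ε-value j ^ t j)
    tail t = begin
      partialSum (λ x → 1ℚ * b x) m        ≡⟨ partialSum-cong (λ x → *-identityˡ (b x)) m ⟩
      S                                    ≡⟨ trans (sym (*-identityˡ S)) (cong (_* S) (sym E*D≡1)) ⟩
      E * ι D * S                          ≡⟨ *-assoc E (ι D) S ⟩
      E * (ι D * S)                        ≤⟨ *-mono-nonNeg E 0≤E (separated-count D b (λ x → product-atLeast-cases t (climbed x)) separated m) ⟩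
      E * (ι D + ι m)                      ≡⟨ solve 3 (λ e d x → e :* (d :+ x) := e :* d :+ x :* e) refl E (ι D) (ι m) ⟩
      E * ι D + ι m * E                    ≡⟨ cong (_+ ι m * E) E*D≡1 ⟩
      1ℚ + ι m * E                         ∎
      where
      D : ℕ
      D = productℕ (λ j → p j ℕ.^ t j)
      E S : ℚ
      E = product (λ j → ε-value j ^ t j)
      b : ℕ → ℚ
      b x = product (λ j → atLeast (t j) (climbed x j))
      S = partialSum b m
      E*D≡1 : E * ι D ≡ 1ℚ
      E*D≡1 = product-inverse ε-value p t (λ j → /-*-cancel 1 (p j) {{prime⇒nonZero (p-prime j)}})
      0≤E : 0ℚ ≤ E
      0≤E = product-nonNeg _ λ j → ^-nonNeg (<⇒≤ (OpenUnitInterval.0<value (ε j))) (t j)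
      -- By coprimality of the prime powers `D` divides the positive number `y - x`, so it cannot
      -- exceed it.
      separated : ∀ x y → x ℕ.< y → (∀ j → t j ℕ.≤ climbed x j) → (∀ j → t j ℕ.≤ climbed y j) → x ℕ.+ D ℕ.≤ y
      separated x y x<y t≤x t≤y = subst (x ℕ.+ D ℕ.≤_) (ℕ.m+[n∸m]≡n (ℕ.<⇒≤ x<y)) (ℕ.+-monoʳ-≤ x
        (ℕ.∣⇒≤ {{ℕ.>-nonZero (ℕ.m<n⇒0<n∸m x<y)}} (subst (D ∣_) (∣+y-+x∣ (ℕ.<⇒≤ x<y))
          (prime-powers-∣ p t p-prime p-inj λ j → ∣-difference (t j) x y j (t≤x j) (t≤y j)))))

-- The bound for polynomials co-prime to `N`.

∣-productℕ : ∀ {ℓ} (v : Vector ℕ ℓ) j → v j ∣ productℕ v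
∣-productℕ v zero    = ℕ.m∣m*n _
∣-productℕ v (suc j) = ℕ.∣-trans (∣-productℕ (Vector.tail v) j) (ℕ.n∣m*n (v zero))

theorem1 : ∀ {ℓ : ℕ} (p r : Vector ℕ ℓ) (p-prime : ∀ i → Prime (p i)) →
    Injective _≡_ _≡_ p →
    (∀ i → 1 ℕ.≤ r i) →
    (N : ℕ) → N ≡ productℕ (λ i → p i ℕ.^ r i) →
    (μ : ℕ) → 1 ℕ.≤ μ →
    (f : Poly μ) → Multilinear f → CoprimeTo N f →
    (m : ℕ) .{{_ : NonZero m}} → 1 ℕ.< m →
    Pr m μ (vanishesMod? f N) ≤ + μ / m + product (λ i → I (reciprocal (p-prime i)) (r i) μ)
theorem1 p r p-prime p-inj 1≤r N N≡ μ _ f ml coprime m 1<m =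
  -- Multiplying by `m ^ (μ + 1)` clears both denominators and gives the form of `vanishing-count`.
  *-cancelʳ-≤-pos (ι m * ι m ^ μ) {{positive 0<scale}} (begin
    Pr m μ (vanishesMod? f N) * (M * M ^ μ)     ≡⟨ solve 3 (λ q x y → q :* (x :* y) := x :* (q :* y)) refl (Pr m μ (vanishesMod? f N)) M (M ^ μ) ⟩
    M * (Pr m μ (vanishesMod? f N) * M ^ μ)     ≡⟨ cong (λ z → M * (Pr m μ (vanishesMod? f N) * z)) (ι-^ m μ) ⟨
    M * (Pr m μ (vanishesMod? f N) * ι (m ℕ.^ μ))
      ≡⟨ cong (M *_) (/-*-cancel (length (filter (vanishesMod? f N) (cube m μ))) (m ℕ.^ μ) {{ℕ.m^n≢0 m μ}}) ⟩
    M * ι (length (filter (vanishesMod? f N) (cube m μ)))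
      -- Nothing is substituted yet: start from `a = 0` with the full exponents `r` still to be
      -- gained.
      ≤⟨ vanishing-count p p-prime p-inj m μ (multiaffine f) (λ _ → 0) r exhausted (vanishesMod? f N) target ⟩
    M ^ μ * (ι μ + M * Π)                       ≡⟨ cong (λ z → M ^ μ * (z + M * Π)) (/-*-cancel μ m) ⟨
    M ^ μ * ((+ μ / m) * M + M * Π)             ≡⟨ solve 4 (λ t y x v → t :* (y :* x :+ x :* v) := (y :+ v) :* (x :* t)) refl (M ^ μ) (+ μ / m) M Π ⟩
    (+ μ / m + Π) * (M * M ^ μ)                 ∎)
  where
  open ≤-Reasoning
  open +-*-Solver
  M Π : ℚ
  M = ι m
  Π = product (λ i → I (reciprocal (p-prime i)) (r i) μ)

  0<M : 0ℚ < M
  0<M = <-≤-trans (positive⁻¹ 1ℚ) (ι-mono (ℕ.<⇒≤ 1<m))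

  ^-pos : ∀ k → 0ℚ < M ^ k
  ^-pos zero    = positive⁻¹ 1ℚ
  ^-pos (suc k) = *-pos 0<M (^-pos k)

  0<scale : 0ℚ < M * M ^ μ
  0<scale = ^-pos (suc μ)

  p^r∣N : ∀ j → p j ℕ.^ r j ∣ N
  p^r∣N j = subst (p j ℕ.^ r j ∣_) (sym N≡) (∣-productℕ (λ i → p i ℕ.^ r i) j)

  -- A prime `p j` dividing all coefficients also divides `N`, since `r j` is at least 1, and hence
  -- the gcd 1.
  exhausted : ∀ j → r j ≡ 0 ⊎ ¬ p j ℕ.^ 1 ∣ᶜ multiaffine f
  exhausted j = inj₂ λ p∣f → ¬prime[1] (subst Prime (ℕ.∣1⇒≡1 (subst (_∣ 1) (ℕ.*-identityʳ (p j))
    (subst (p j ℕ.^ 1 ∣_) coprime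
      (∣-gcds (coeffs f) (ℕ.∣-trans (^-monoʳ-∣ (p j) (1≤r j)) (p^r∣N j)) (∣ᶜ-multiaffine f ml p∣f))))) (p-prime j))

  target : ∀ {xs} → + N ℤ.∣ eval f xs → ∀ j → p j ℕ.^ r j ∣ℤ evalᴹ (multiaffine f) xs
  target {xs} N∣ j = subst (p j ℕ.^ r j ∣ℤ_) (sym (evalᴹ-multiaffine f ml xs)) (ℤ.∣-trans (ℤ.∣ᵤ⇒∣ (p^r∣N j)) N∣)
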